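{- Let $P \subseteq \omega$ be such that $P \gg \emptyset''$. Then every $\emptyset'$-recursive sequence $\vec{R} = (R_n : n\in\omega)$ of subsets of $\omega$ admits an infinite $\vec{R}$-cohesive set $X$ with $X'' \leq_T X \oplus \emptyset'' \leq_T P$.
   Context: An $\vec{R}$-cohesive set is an infinite $C\subseteq\omega$ such that for each $n$, either $C\setminus R_n$ or $C\cap R_n$ is finite. A function $f:\omega\to 2$ is PA for $Y$ if $f(e)\neq\Phi_e(Y;e)$ whenever $\Phi_e(Y;e)$ converges ($\Phi_e$ the $e$-th Turing functional). $P \gg Y$ means that $P$ computes a function which is PA for $Y$. $X''$ denotes the second Turing jump of $X$. -}

module Defs where

open import Data.Nat using (ℕ; zero; suc; _+_; _*_; _≤_; _<_)
open import Data.Product using (Σ; ∃; _×_; _,_; proj₁; proj₂)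
open import Data.Sum using (_⊎_)
open import Data.Empty using (⊥)
open import Relation.Nullary using (¬_)
open import Relation.Binary.PropositionalEquality using (_≡_; _≢_)

-- Subsets of ω are predicates on ℕ (so that non-decidable sets such as
-- jumps can be represented).

Pred : Set₁
Pred = ℕ → Set

-- Cantor pairing  ⟨a,b⟩ = tri (a+b) + a,  tri k = k(k+1)/2,
-- and its inverse, defined by enumerating pairs along diagonals.

tri : ℕ → ℕ
tri zero    = 0
tri (suc k) = suc k + tri k

pair : ℕ → ℕ → ℕ
pair a b = tri (a + b) + a

private
  next : ℕ × ℕ → ℕ × ℕ
  next (a , zero)  = (0 , suc a)
  next (a , suc b) = (suc a , b)

unpair : ℕ → ℕ × ℕ
unpair zero    = (0 , 0)
unpair (suc n) = next (unpair n)

fst snd : ℕ → ℕ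
fst n = proj₁ (unpair n)
snd n = proj₂ (unpair n)

-- Oracle partial recursive functions (unary, with pairing).
--   Zc x = 0, Sc x = x+1, Ic x = x, Oc x = χ_A(x),
--   Fc x = fst x, Dc x = snd x, Pc f g x = ⟨f x , g x⟩,
--   Cc f g x = f (g x),
--   Rc f g ⟨x,0⟩ = f x,  Rc f g ⟨x,n+1⟩ = g ⟨x,⟨n, Rc f g ⟨x,n⟩⟩⟩,
--   Mc f x = μn. f ⟨x,n⟩ = 0.

data Code : Set where
  Zc Sc Ic Oc Fc Dc : Code
  Pc Cc Rc : Code → Code → Code
  Mc : Code → Code

data Eval (A : Pred) : Code → ℕ → ℕ → Set where
  ev-Z  : ∀ {x} → Eval A Zc x 0
  ev-S  : ∀ {x} → Eval A Sc x (suc x)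
  ev-I  : ∀ {x} → Eval A Ic x x
  ev-O1 : ∀ {x} → A x → Eval A Oc x 1
  ev-O0 : ∀ {x} → ¬ A x → Eval A Oc x 0
  ev-F  : ∀ {x} → Eval A Fc x (fst x)
  ev-D  : ∀ {x} → Eval A Dc x (snd x)
  ev-P  : ∀ {f g x a b} → Eval A f x a → Eval A g x b → Eval A (Pc f g) x (pair a b)
  ev-C  : ∀ {f g x y z} → Eval A g x y → Eval A f y z → Eval A (Cc f g) x z
  ev-R0 : ∀ {f g x y} → Eval A f x y → Eval A (Rc f g) (pair x 0) y
  ev-RS : ∀ {f g x n y z} → Eval A (Rc f g) (pair x n) y →
          Eval A g (pair x (pair n y)) z → Eval A (Rc f g) (pair x (suc n)) z
  ev-M  : ∀ {f x n} → Eval A f (pair x n) 0 →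
          (∀ m → m < n → ∃ λ k → Eval A f (pair x m) (suc k)) →
          Eval A (Mc f) x n

-- Gödel numbering: decode e is the e-th program (every code occurs).
-- n = ⟨tag, r⟩, binary constructors read r = ⟨a,b⟩; fuel guarantees
-- termination (components of n are < n whenever they are used).

private
  dec : ℕ → ℕ → Code
  dec zero    n = Zc
  dec (suc k) n = sel (fst n) (snd n)
    where
    sel : ℕ → ℕ → Code
    sel 0 r = Zc
    sel 1 r = Sc
    sel 2 r = Ic
    sel 3 r = Oc
    sel 4 r = Fc
    sel 5 r = Dc
    sel 6 r = Pc (dec k (fst r)) (dec k (snd r))
    sel 7 r = Cc (dec k (fst r)) (dec k (snd r))
    sel 8 r = Rc (dec k (fst r)) (dec k (snd r))
    sel 9 r = Mc (dec k r)
    sel _ r = Zc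

decode : ℕ → Code
decode e = dec e e

Φ : ℕ → Pred → ℕ → ℕ → Set
Φ e A x y = Eval A (decode e) x y

∅ : Pred
∅ _ = ⊥

_′ : Pred → Pred
(A ′) e = ∃ λ y → Φ e A e y

_⊕_ : Pred → Pred → Pred
(A ⊕ B) x = Σ ℕ λ k → (x ≡ k + k × A k) ⊎ (x ≡ suc (k + k) × B k)

_≤T_ : Pred → Pred → Set
A ≤T B = Σ Code λ c → ∀ x → (A x → Eval B c x 1) × (¬ A x → Eval B c x 0)

Computes : Pred → (ℕ → ℕ) → Set
Computes P f = Σ Code λ c → ∀ x → Eval P c x (f x)

IsPA : Pred → (ℕ → ℕ) → Set
IsPA Y f = (∀ e → f e ≤ 1) × (∀ e y → Φ e Y e y → f e ≢ y)

_≫_ : Pred → Pred → Set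
P ≫ Y = Σ (ℕ → ℕ) λ f → Computes P f × IsPA Y f

seqSet : (ℕ → Pred) → Pred
seqSet R z = R (fst z) (snd z)

Infinite : Pred → Set
Infinite C = ∀ m → ∃ λ x → m ≤ x × C x

Finite : Pred → Set
Finite S = ∃ λ b → ∀ x → S x → x < b

Cohesive : (ℕ → Pred) → Pred → Set
Cohesive R C = Infinite C ×
  (∀ n → Finite (λ x → C x × ¬ R n x) ⊎ Finite (λ x → C x × R n x))

-- Call a class of sets large if every finite colouring of ω has a colour class in it. A finite
-- string F, a program e and a witness u for "e ∈ X″" (a Σ₂ statement about X) determine the open class of
-- all Y inside which F can be extended to a string refuting u. Whether finitely many such classes have a
-- non-large intersection is a Σ₂ question. So ∅″ can go through all triples κ = (e, F, L), where L
-- is a finite intersection of colour classes of ∅′-recursive colourings, and greedily accept κ when all the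
-- classes for strings extending F inside L and all u can be added to those accepted so far while
-- keeping the intersection large. Let C be the resulting collection. Reservoirs L are kept C-large
-- ("alive"), a Π₁(∅″) condition which survives splitting L by a colouring, for one of the colours; P ≫ ∅″
-- finds that colour. At stage e with condition (F, L), if (e, F, L) is accepted then every later condition
-- can be extended to refute any given witness, so e ∉ X″. If it is rejected, compactness gives an ∅′-recursive
-- colouring each of whose classes misses a class named by C or by (e, F, L); an alive
-- cell meets everything in C, so it misses the class of some (τ, u), and passing to τ inside this cell
-- makes u a true witness, so e ∈ X″. Colours chosen at a stage are those of all later elements of X, so
-- X ⊕ ∅″ can retrace the construction; refining by R n at stage n makes X cohesive.
module Submission where

open import Defs
open import Data.Nat using (ℕ; zero; suc; pred; _+_; _*_; _∸_; _≤_; _<_; z≤n; s≤s)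
open import Data.Nat.Properties
open import Data.Product using (Σ; ∃; _×_; _,_; proj₁; proj₂)
open import Data.Sum using (_⊎_; inj₁; inj₂; [_,_]′)
open import Data.Empty using (⊥; ⊥-elim)
open import Data.Unit using (⊤; tt)
open import Function using (_∘_; id)
open import Relation.Nullary using (¬_; yes; no)
open import Relation.Binary.PropositionalEquality
open import Relation.Binary.Definitions using (tri<; tri≈; tri>)
open import Axiom.ExcludedMiddle using (ExcludedMiddle)
open import Level using (0ℓ)

-- Arithmetic of the Cantor pairing, and decoding without fuel.

unpair-next₀ : ∀ n {a} → unpair n ≡ (a , 0) → unpair (suc n) ≡ (0 , suc a)
unpair-next₀ n p rewrite p = refl

unpair-next : ∀ n {a b} → unpair n ≡ (a , suc b) → unpair (suc n) ≡ (suc a , b)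
unpair-next n p rewrite p = refl

unpair-tri : ∀ s a b → a + b ≡ s → unpair (tri s + a) ≡ (a , b)
unpair-tri zero zero zero _ = refl
unpair-tri (suc s) zero b refl =
  trans (cong unpair (trans (+-identityʳ (suc (s + tri s))) (cong suc (+-comm s (tri s)))))
        (unpair-next₀ (tri s + s) (unpair-tri s s 0 (+-identityʳ s)))
unpair-tri (suc s) (suc a) b p =
  trans (cong unpair (+-suc (tri (suc s)) a))
        (unpair-next (tri (suc s) + a) (unpair-tri (suc s) a (suc b) (trans (+-suc a b) p)))

fst-pair : ∀ a b → fst (pair a b) ≡ a
fst-pair a b = cong proj₁ (unpair-tri (a + b) a b refl)

snd-pair : ∀ a b → snd (pair a b) ≡ b
snd-pair a b = cong proj₂ (unpair-tri (a + b) a b refl)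

pair-η : ∀ n → pair (fst n) (snd n) ≡ n
pair-η zero = refl
pair-η (suc n) with unpair n | pair-η n
... | a , zero  | p = cong suc (trans (+-identityʳ (a + tri a))
                        (trans (+-comm a (tri a)) (trans (cong (λ z → tri z + a) (sym (+-identityʳ a))) p)))
... | a , suc b | p = trans (+-suc (tri (suc a + b)) a)
                        (cong suc (trans (cong (λ z → tri z + a) (sym (+-suc a b))) p))

tri-≥ : ∀ s → s ≤ tri s
tri-≥ zero = z≤n
tri-≥ (suc s) = m≤m+n (suc s) (tri s)

tri-mono : ∀ {s t} → s ≤ t → tri s ≤ tri t
tri-mono z≤n = z≤n
tri-mono (s≤s p) = s≤s (+-mono-≤ p (tri-mono p))

pair-mono : ∀ {a a' b b'} → a ≤ a' → b ≤ b' → pair a b ≤ pair a' b'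
pair-mono p q = +-mono-≤ (tri-mono (+-mono-≤ p q)) p

≤-pairˡ : ∀ a b → a ≤ pair a b
≤-pairˡ a b = m≤n+m a (tri (a + b))

≤-pairʳ : ∀ a b → b ≤ pair a b
≤-pairʳ a b = ≤-trans (m≤n+m b a) (≤-trans (tri-≥ (a + b)) (m≤m+n _ a))

fst-≤ : ∀ n → fst n ≤ n
fst-≤ n = subst (fst n ≤_) (pair-η n) (≤-pairˡ (fst n) (snd n))

snd-≤ : ∀ n → snd n ≤ n
snd-≤ n = subst (snd n ≤_) (pair-η n) (≤-pairʳ (fst n) (snd n))

snd-< : ∀ n {t} → fst n ≡ suc t → snd n < n
snd-< n {t} p = subst (snd n <_) (pair-η n) (subst (λ a → snd n < pair a (snd n)) (sym p)
  (≤-trans (s≤s (m≤n+m (snd n) t)) (≤-trans (tri-≥ (suc t + snd n)) (m≤m+n _ (suc t)))))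

-- The fuelled decoder of Defs is private; unification recovers its selector, and
-- branch 9 of the selector gives the decoder back.
mutual
  selector : ℕ → ℕ → ℕ → ℕ → Code
  selector = _

  decode-suc : ∀ k → decode (suc k) ≡ selector k (suc k) (fst (suc k)) (snd (suc k))
  decode-suc k with suc k | fst (suc k) | snd (suc k)
  ... | n | t | r = refl

unMc : Code → Code
unMc (Mc c) = c
unMc c = c

decodeFuel : ℕ → ℕ → Code
decodeFuel k n = unMc (selector k 0 9 n)

-- A nonzero tag makes the payload smaller than `n`, so every recursive call still has enough fuel
-- on both sides.
decodeFuel-stable : ∀ k k' n → n ≤ k → n ≤ k' → decodeFuel k n ≡ decodeFuel k' n
decodeFuel-stable zero zero n p q = refl
decodeFuel-stable zero (suc k') zero p q = refl
decodeFuel-stable (suc k) zero zero p q = refl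
decodeFuel-stable (suc k) (suc k') n p q = go (fst n) (snd n) λ eq → snd-< n eq
  where
  go : ∀ t r → (∀ {t'} → t ≡ suc t' → r < n) → selector k n t r ≡ selector k' n t r
  go 0 r h = refl
  go 1 r h = refl
  go 2 r h = refl
  go 3 r h = refl
  go 4 r h = refl
  go 5 r h = refl
  go (suc (suc (suc (suc (suc (suc t)))))) r h = go' t
    where
    sub : ∀ {m} → m ≤ r → decodeFuel k m ≡ decodeFuel k' m
    sub m≤r = decodeFuel-stable k k' _ (below p) (below q)
      where
      below : ∀ {j} → n ≤ suc j → _ ≤ j
      below n≤ = ≤-pred (≤-trans (s≤s m≤r) (≤-trans (h refl) n≤))
    go' : ∀ t → selector k n (6 + t) r ≡ selector k' n (6 + t) r
    go' 0 = cong₂ Pc (sub (fst-≤ r)) (sub (snd-≤ r))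
    go' 1 = cong₂ Cc (sub (fst-≤ r)) (sub (snd-≤ r))
    go' 2 = cong₂ Rc (sub (fst-≤ r)) (sub (snd-≤ r))
    go' 3 = cong Mc (sub ≤-refl)
    go' (suc (suc (suc (suc t)))) = refl

branchᶠ : ℕ → ℕ → Code
branchᶠ 0 r = Zc
branchᶠ 1 r = Sc
branchᶠ 2 r = Ic
branchᶠ 3 r = Oc
branchᶠ 4 r = Fc
branchᶠ 5 r = Dc
branchᶠ 6 r = Pc (decode (fst r)) (decode (snd r))
branchᶠ 7 r = Cc (decode (fst r)) (decode (snd r))
branchᶠ 8 r = Rc (decode (fst r)) (decode (snd r))
branchᶠ 9 r = Mc (decode r)
branchᶠ (suc (suc (suc (suc (suc (suc (suc (suc (suc (suc t)))))))))) r = Zc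

decode-branchᶠ : ∀ e → decode e ≡ branchᶠ (fst e) (snd e)
decode-branchᶠ zero = refl
decode-branchᶠ (suc k) = trans (decode-suc k) (go (fst n) refl)
  where
  n = suc k
  r = snd n
  fuel : ∀ {m t} → fst n ≡ suc t → m ≤ r → decodeFuel k m ≡ decode m
  fuel {m} eq m≤r = decodeFuel-stable k m m (≤-pred (≤-trans (s≤s m≤r) (snd-< n eq))) ≤-refl
  go : ∀ t → fst n ≡ t → selector k n t r ≡ branchᶠ t r
  go 0 eq = refl
  go 1 eq = refl
  go 2 eq = refl
  go 3 eq = refl
  go 4 eq = refl
  go 5 eq = refl
  go 6 eq = cong₂ Pc (fuel eq (fst-≤ r)) (fuel eq (snd-≤ r))
  go 7 eq = cong₂ Cc (fuel eq (fst-≤ r)) (fuel eq (snd-≤ r))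
  go 8 eq = cong₂ Rc (fuel eq (fst-≤ r)) (fuel eq (snd-≤ r))
  go 9 eq = cong Mc (fuel eq ≤-refl)
  go (suc (suc (suc (suc (suc (suc (suc (suc (suc (suc t)))))))))) eq = refl

-- Determinism of evaluation.

pair-injective : ∀ a b a' b' → pair a b ≡ pair a' b' → a ≡ a' × b ≡ b'
pair-injective a b a' b' p =
  trans (sym (fst-pair a b)) (trans (cong fst p) (fst-pair a' b')) ,
  trans (sym (snd-pair a b)) (trans (cong snd p) (snd-pair a' b'))

-- The inputs are related by an equation because `pair x 0` and `pair x (suc n)` are not in
-- constructor form; injectivity of pairing then separates the two recursion rules.
Eval-det : ∀ {A c x y x' y'} → Eval A c x y → x ≡ x' → Eval A c x' y' → y ≡ y'
Eval-det ev-Z refl ev-Z = refl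
Eval-det ev-S refl ev-S = refl
Eval-det ev-I refl ev-I = refl
Eval-det (ev-O1 a) refl (ev-O1 b) = refl
Eval-det (ev-O1 a) refl (ev-O0 b) = ⊥-elim (b a)
Eval-det (ev-O0 a) refl (ev-O1 b) = ⊥-elim (a b)
Eval-det (ev-O0 a) refl (ev-O0 b) = refl
Eval-det ev-F refl ev-F = refl
Eval-det ev-D refl ev-D = refl
Eval-det (ev-P p q) refl (ev-P p' q') = cong₂ pair (Eval-det p refl p') (Eval-det q refl q')
Eval-det (ev-C p q) refl (ev-C p' q') = Eval-det q (Eval-det p refl p') q'
Eval-det (ev-R0 {x = x} p) eq (ev-R0 {x = x'} p') = Eval-det p (proj₁ (pair-injective x 0 x' 0 eq)) p'
Eval-det (ev-R0 {x = x} p) eq (ev-RS {x = x'} {n = n} p' q') with pair-injective x 0 x' (suc n) eq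
... | _ , ()
Eval-det (ev-RS {x = x} {n = n} p q) eq (ev-R0 {x = x'} p') with pair-injective x (suc n) x' 0 eq
... | _ , ()
Eval-det (ev-RS {x = x} {n = n} p q) eq (ev-RS {x = x'} {n = n'} p' q')
  with pair-injective x (suc n) x' (suc n') eq
... | refl , refl with Eval-det p refl p'
... | refl = Eval-det q refl q'
Eval-det (ev-M {n = n} p h) refl (ev-M {n = n'} p' h') with <-cmp n n'
... | tri≈ _ n≡n' _ = n≡n'
... | tri< n<n' _ _ with h' n n<n'
...   | _ , q with Eval-det p refl q
...     | ()
Eval-det (ev-M {n = n} p h) refl (ev-M {n = n'} p' h') | tri> _ _ n'<n with h n' n'<n
...   | _ , q with Eval-det q refl p'
...     | ()

-- Relative computability: coding of programs.

module Computability (em : ExcludedMiddle 0ℓ) where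

  -- Opaque copies of the pairing functions: neutral heads let unification see through them.
  opaque
    ⟨_,_⟩ : ℕ → ℕ → ℕ
    ⟨ a , b ⟩ = pair a b

    π₁ π₂ : ℕ → ℕ
    π₁ = fst
    π₂ = snd

    ⟨⟩-pair : ∀ a b → ⟨ a , b ⟩ ≡ pair a b
    ⟨⟩-pair a b = refl

    π₁-fst : ∀ n → π₁ n ≡ fst n
    π₁-fst n = refl

    π₂-snd : ∀ n → π₂ n ≡ snd n
    π₂-snd n = refl

    π₁-⟨⟩ : ∀ a b → π₁ ⟨ a , b ⟩ ≡ a
    π₁-⟨⟩ = fst-pair

    π₂-⟨⟩ : ∀ a b → π₂ ⟨ a , b ⟩ ≡ b
    π₂-⟨⟩ = snd-pair

    ⟨⟩-η : ∀ n → ⟨ π₁ n , π₂ n ⟩ ≡ n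
    ⟨⟩-η = pair-η

    ⟨⟩-mono : ∀ {a a' b b'} → a ≤ a' → b ≤ b' → ⟨ a , b ⟩ ≤ ⟨ a' , b' ⟩
    ⟨⟩-mono = pair-mono

    π₁-≤ : ∀ n → π₁ n ≤ n
    π₁-≤ = fst-≤

    π₂-≤ : ∀ n → π₂ n ≤ n
    π₂-≤ = snd-≤

    π-zero : π₁ 0 ≡ 0 × π₂ 0 ≡ 0
    π-zero = refl , refl

  branch : ℕ → ℕ → Code
  branch 0 r = Zc
  branch 1 r = Sc
  branch 2 r = Ic
  branch 3 r = Oc
  branch 4 r = Fc
  branch 5 r = Dc
  branch 6 r = Pc (decode (π₁ r)) (decode (π₂ r))
  branch 7 r = Cc (decode (π₁ r)) (decode (π₂ r))
  branch 8 r = Rc (decode (π₁ r)) (decode (π₂ r))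
  branch 9 r = Mc (decode r)
  branch (suc (suc (suc (suc (suc (suc (suc (suc (suc (suc t)))))))))) r = Zc

  decode-branch : ∀ e → decode e ≡ branch (π₁ e) (π₂ e)
  decode-branch e = trans (decode-branchᶠ e) (trans (cong₂ branchᶠ (sym (π₁-fst e)) (sym (π₂-snd e))) (go (π₁ e)))
    where
    r = π₂ e
    d₁ : decode (fst r) ≡ decode (π₁ r)
    d₁ = cong decode (sym (π₁-fst r))
    d₂ : decode (snd r) ≡ decode (π₂ r)
    d₂ = cong decode (sym (π₂-snd r))
    go : ∀ t → branchᶠ t r ≡ branch t r
    go 0 = refl
    go 1 = refl
    go 2 = refl
    go 3 = refl
    go 4 = refl
    go 5 = refl
    go 6 = cong₂ Pc d₁ d₂
    go 7 = cong₂ Cc d₁ d₂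
    go 8 = cong₂ Rc d₁ d₂
    go 9 = refl
    go (suc (suc (suc (suc (suc (suc (suc (suc (suc (suc t)))))))))) = refl

  decode-⟨⟩ : ∀ t r → decode ⟨ t , r ⟩ ≡ branch t r
  decode-⟨⟩ t r = trans (decode-branch ⟨ t , r ⟩) (cong₂ branch (π₁-⟨⟩ t r) (π₂-⟨⟩ t r))

  encode : Code → ℕ
  encode Zc = ⟨ 0 , 0 ⟩
  encode Sc = ⟨ 1 , 0 ⟩
  encode Ic = ⟨ 2 , 0 ⟩
  encode Oc = ⟨ 3 , 0 ⟩
  encode Fc = ⟨ 4 , 0 ⟩
  encode Dc = ⟨ 5 , 0 ⟩
  encode (Pc f g) = ⟨ 6 , ⟨ encode f , encode g ⟩ ⟩
  encode (Cc f g) = ⟨ 7 , ⟨ encode f , encode g ⟩ ⟩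
  encode (Rc f g) = ⟨ 8 , ⟨ encode f , encode g ⟩ ⟩
  encode (Mc f) = ⟨ 9 , encode f ⟩

  decode-encode : ∀ c → decode (encode c) ≡ c
  decode-encode₂ : ∀ f g → (decode (π₁ ⟨ encode f , encode g ⟩) ≡ f)
                          × (decode (π₂ ⟨ encode f , encode g ⟩) ≡ g)
  decode-encode₂ f g =
    trans (cong decode (π₁-⟨⟩ (encode f) (encode g))) (decode-encode f) ,
    trans (cong decode (π₂-⟨⟩ (encode f) (encode g))) (decode-encode g)
  decode-encode Zc = decode-⟨⟩ 0 0
  decode-encode Sc = decode-⟨⟩ 1 0
  decode-encode Ic = decode-⟨⟩ 2 0
  decode-encode Oc = decode-⟨⟩ 3 0
  decode-encode Fc = decode-⟨⟩ 4 0
  decode-encode Dc = decode-⟨⟩ 5 0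
  decode-encode (Pc f g) = let p , q = decode-encode₂ f g in trans (decode-⟨⟩ 6 _) (cong₂ Pc p q)
  decode-encode (Cc f g) = let p , q = decode-encode₂ f g in trans (decode-⟨⟩ 7 _) (cong₂ Cc p q)
  decode-encode (Rc f g) = let p , q = decode-encode₂ f g in trans (decode-⟨⟩ 8 _) (cong₂ Rc p q)
  decode-encode (Mc f) = trans (decode-⟨⟩ 9 _) (cong Mc (decode-encode f))

  -- Closure properties of recursive functions and decidable predicates.

  record Rec (A : Pred) (f : ℕ → ℕ) : Set where
    constructor rec
    field
      prog : Code
      run  : ∀ x → Eval A prog x (f x)

  record Dcd (A : Pred) (Q : ℕ → Set) : Set where
    constructor dcd
    field
      test : Code
      pos  : ∀ x → Q x → Eval A test x 1
      neg  : ∀ x → ¬ Q x → Eval A test x 0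

  open Rec
  open Dcd

  fromT : ∀ {A B} → B ≤T A → Dcd A B
  fromT (c , h) = dcd c (λ x → proj₁ (h x)) (λ x → proj₂ (h x))

  toT : ∀ {A B} → Dcd A B → B ≤T A
  toT (dcd c p n) = c , λ x → p x , n x

  opaque
    -- A classical truth value. It carries no algorithm; computability of `χ (Q x)` in `x` comes
    -- only from a `Dcd` through `r-χ`.
    χ : Set → ℕ
    χ Q with em {Q}
    ... | yes _ = 1
    ... | no _  = 0

    χ-yes : ∀ {Q} → Q → χ Q ≡ 1
    χ-yes {Q} q with em {Q}
    ... | yes _ = refl
    ... | no ¬q = ⊥-elim (¬q q)

    χ-no : ∀ {Q} → ¬ Q → χ Q ≡ 0
    χ-no {Q} ¬q with em {Q}
    ... | yes q = ⊥-elim (¬q q)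
    ... | no _ = refl

    χ-≤1 : ∀ {Q} → χ Q ≤ 1
    χ-≤1 {Q} with em {Q}
    ... | yes _ = s≤s z≤n
    ... | no _ = z≤n

    χ-inv : ∀ {Q} → χ Q ≡ 1 → Q
    χ-inv {Q} p with em {Q}
    ... | yes q = q

    χ-inv0 : ∀ {Q} → χ Q ≡ 0 → ¬ Q
    χ-inv0 {Q} p with em {Q}
    ... | no ¬q = ¬q

  byContra : {Q : Set} → (¬ Q → ⊥) → Q
  byContra {Q} h with em {Q}
  ... | yes q = q
  ... | no ¬q = ⊥-elim (h ¬q)

  ¬∀⇒∃¬ : {Q : ℕ → Set} → ¬ (∀ n → Q n) → ∃ λ n → ¬ Q n
  ¬∀⇒∃¬ h = byContra λ ¬e → h λ n → byContra λ ¬q → ¬e (n , ¬q)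

  natrec : ℕ → (ℕ → ℕ → ℕ) → ℕ → ℕ
  natrec b s zero = b
  natrec b s (suc n) = s n (natrec b s n)

  if0 : ℕ → ℕ → ℕ → ℕ
  if0 n a b = natrec a (λ _ _ → b) n

  private variable
    A B : Pred
    f g h : ℕ → ℕ
    Q Q' : ℕ → Set
    q : ℕ → ℕ → Set
    s : ℕ → ℕ → ℕ → ℕ

  rec-ext : (∀ x → f x ≡ g x) → Rec A f → Rec A g
  rec-ext e r = rec (prog r) λ x → subst (Eval _ (prog r) x) (e x) (run r x)

  r-id : Rec A (λ x → x)
  r-id = rec Ic λ x → ev-I

  r-suc : Rec A f → Rec A (λ x → suc (f x))
  r-suc r = rec (Cc Sc (prog r)) λ x → ev-C (run r x) ev-S

  constCode : ℕ → Code
  constCode zero = Zc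
  constCode (suc n) = Cc Sc (constCode n)

  constCode-run : ∀ n {x} → Eval A (constCode n) x n
  constCode-run zero = ev-Z
  constCode-run (suc n) = ev-C (constCode-run n) ev-S

  r-const : ∀ n → Rec A (λ _ → n)
  r-const n = rec (constCode n) λ x → constCode-run n

  r-π₁ : Rec A f → Rec A (λ x → π₁ (f x))
  r-π₁ {f = f} r = rec-ext (λ x → sym (π₁-fst (f x))) (rec (Cc Fc (prog r)) λ x → ev-C (run r x) ev-F)

  r-π₂ : Rec A f → Rec A (λ x → π₂ (f x))
  r-π₂ {f = f} r = rec-ext (λ x → sym (π₂-snd (f x))) (rec (Cc Dc (prog r)) λ x → ev-C (run r x) ev-D)

  r-⟨⟩ : Rec A f → Rec A g → Rec A (λ x → ⟨ f x , g x ⟩)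
  r-⟨⟩ {f = f} {g = g} r t = rec-ext (λ x → sym (⟨⟩-pair (f x) (g x)))
    (rec (Pc (prog r) (prog t)) λ x → ev-P (run r x) (run t x))

  _∘r_ : Rec A f → Rec A g → Rec A (λ x → f (g x))
  _∘r_ {g = g} r t = rec (Cc (prog r) (prog t)) λ x → ev-C (run t x) (run r (g x))

  _↑ : Rec A f → Rec A (λ z → f (π₁ z))
  r ↑ = r ∘r r-π₁ r-id

  v0 : Rec A π₂
  v0 = r-π₂ r-id

  v1 : Rec A (λ z → π₂ (π₁ z))
  v1 = v0 ↑

  v2 : Rec A (λ z → π₂ (π₁ (π₁ z)))
  v2 = v1 ↑

  d-resp : (∀ x → Q x → Q' x) → (∀ x → Q' x → Q x) → Dcd A Q → Dcd A Q'
  d-resp i j d = dcd (test d) (λ x q' → pos d x (j x q')) (λ x ¬q' → neg d x (¬q' ∘ i x))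

  d-∘ : Dcd A Q → Rec A f → Dcd A (λ x → Q (f x))
  d-∘ {f = f} d r = dcd (Cc (test d) (prog r)) (λ x q → ev-C (run r x) (pos d (f x) q))
                                               (λ x ¬q → ev-C (run r x) (neg d (f x) ¬q))

  d-∘₂ : Dcd A (λ z → q (π₁ z) (π₂ z)) → Rec A f → Rec A g → Dcd A (λ x → q (f x) (g x))
  d-∘₂ {q = q} {f = f} {g = g} d r t =
    d-resp (λ x → subst₂ q (π₁-⟨⟩ (f x) (g x)) (π₂-⟨⟩ (f x) (g x)))
           (λ x → subst₂ q (sym (π₁-⟨⟩ (f x) (g x))) (sym (π₂-⟨⟩ (f x) (g x))))
           (d-∘ d (r-⟨⟩ r t))

  r-∘₂ : ∀ {k : ℕ → ℕ → ℕ} → Rec A (λ z → k (π₁ z) (π₂ z)) → Rec A f → Rec A g → Rec A (λ x → k (f x) (g x))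
  r-∘₂ {f = f} {g = g} {k = k} d r t =
    rec-ext (λ x → cong₂ k (π₁-⟨⟩ (f x) (g x)) (π₂-⟨⟩ (f x) (g x))) (d ∘r r-⟨⟩ r t)

  r-χ : Dcd A Q → Rec A (λ x → χ (Q x))
  r-χ {A} {Q} d = rec (test d) go
    where
    go : ∀ x → Eval A (test d) x (χ (Q x))
    go x with em {Q x}
    ... | yes q = subst (Eval A (test d) x) (sym (χ-yes q)) (pos d x q)
    ... | no ¬q = subst (Eval A (test d) x) (sym (χ-no ¬q)) (neg d x ¬q)

  d-char : Rec A f → (∀ x → Q x → f x ≡ 1) → (∀ x → ¬ Q x → f x ≡ 0) → Dcd A Q
  d-char r y n = dcd (prog r) (λ x q → subst (Eval _ (prog r) x) (y x q) (run r x))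
                              (λ x ¬q → subst (Eval _ (prog r) x) (n x ¬q) (run r x))

  r-natrec : Rec A f → Rec A (λ z → s (π₁ z) (π₁ (π₂ z)) (π₂ (π₂ z))) → Rec A g →
             Rec A (λ x → natrec (f x) (s x) (g x))
  r-natrec {A} {f} {s} {g} b st n =
    rec (Cc (Rc (prog b) (prog st)) (Pc Ic (prog n))) λ x → ev-C (ev-P ev-I (run n x)) (go x (g x))
    where
    go : ∀ x m → Eval A (Rc (prog b) (prog st)) (pair x m) (natrec (f x) (s x) m)
    go x zero = ev-R0 {x = x} (run b x)
    go x (suc m) = ev-RS {x = x} {n = m} (go x m) (subst₂ (Eval A (prog st)) arg val (run st ⟨ x , ⟨ m , y ⟩ ⟩))
      where
      y = natrec (f x) (s x) m
      arg = trans (⟨⟩-pair x ⟨ m , y ⟩) (cong (pair x) (⟨⟩-pair m y))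
      val : s (π₁ ⟨ x , ⟨ m , y ⟩ ⟩) (π₁ (π₂ ⟨ x , ⟨ m , y ⟩ ⟩)) (π₂ (π₂ ⟨ x , ⟨ m , y ⟩ ⟩)) ≡ s x m y
      val rewrite π₁-⟨⟩ x ⟨ m , y ⟩ | π₂-⟨⟩ x ⟨ m , y ⟩ | π₁-⟨⟩ m y | π₂-⟨⟩ m y = refl

  r-if0 : Rec A f → Rec A g → Rec A h → Rec A (λ x → if0 (f x) (g x) (h x))
  r-if0 c a b = r-natrec a (b ↑) c

  r-pred : Rec A f → Rec A (λ x → pred (f x))
  r-pred {f = f} r = rec-ext (λ x → eq (f x)) (r-natrec (r-const 0) (r-π₁ v0) r)
    where
    eq : ∀ n → natrec 0 (λ k _ → k) n ≡ pred n
    eq zero = refl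
    eq (suc n) = refl

  r-+ : Rec A f → Rec A g → Rec A (λ x → f x + g x)
  r-+ {f = f} {g = g} r t = rec-ext (λ x → eq (f x) (g x)) (r-natrec r (r-suc (r-π₂ v0)) t)
    where
    eq : ∀ m n → natrec m (λ _ y → suc y) n ≡ m + n
    eq m zero = sym (+-identityʳ m)
    eq m (suc n) = trans (cong suc (eq m n)) (sym (+-suc m n))

  r-∸ : Rec A f → Rec A g → Rec A (λ x → f x ∸ g x)
  r-∸ {f = f} {g = g} r t = rec-ext (λ x → eq (f x) (g x)) (r-natrec r (r-pred (r-π₂ v0)) t)
    where
    eq : ∀ m n → natrec m (λ _ y → pred y) n ≡ m ∸ n
    eq m zero = refl
    eq m (suc n) = trans (cong pred (eq m n)) (pred[m∸n]≡m∸[1+n] m n)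

  d-¬ : Dcd A Q → Dcd A (λ x → ¬ Q x)
  d-¬ d = d-char (r-if0 (r-χ d) (r-const 1) (r-const 0))
    (λ x ¬q → cong (λ n → if0 n 1 0) (χ-no ¬q))
    (λ x ¬¬q → cong (λ n → if0 n 1 0) (χ-yes (byContra ¬¬q)))

  d-× : Dcd A Q → Dcd A Q' → Dcd A (λ x → Q x × Q' x)
  d-× {Q = Q} {Q' = Q'} d e = d-char (r-if0 (r-χ d) (r-const 0) (r-χ e)) y n
    where
    y : ∀ x → Q x × Q' x → if0 (χ (Q x)) 0 (χ (Q' x)) ≡ 1
    y x (q , q') rewrite χ-yes q | χ-yes q' = refl
    n : ∀ x → ¬ (Q x × Q' x) → if0 (χ (Q x)) 0 (χ (Q' x)) ≡ 0
    n x ¬q with em {Q x}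
    ... | no ¬q₁ rewrite χ-no ¬q₁ = refl
    ... | yes q rewrite χ-yes q = χ-no (λ q' → ¬q (q , q'))

  d-⊎ : Dcd A Q → Dcd A Q' → Dcd A (λ x → Q x ⊎ Q' x)
  d-⊎ d e = d-resp
    (λ x k → byContra λ ¬s → k ((λ q → ¬s (inj₁ q)) , (λ q → ¬s (inj₂ q))))
    (λ { x (inj₁ q) (¬q , _) → ¬q q ; x (inj₂ q) (_ , ¬q) → ¬q q })
    (d-¬ (d-× (d-¬ d) (d-¬ e)))

  d-→ : Dcd A Q → Dcd A Q' → Dcd A (λ x → Q x → Q' x)
  d-→ d e = d-resp
    (λ x k q → byContra λ ¬q' → k (q , ¬q'))
    (λ x i (q , ¬q') → ¬q' (i q))
    (d-¬ (d-× d (d-¬ e)))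

  d-≤ : Rec A f → Rec A g → Dcd A (λ x → f x ≤ g x)
  d-≤ {f = f} {g = g} r t = d-char (r-if0 (r-∸ r t) (r-const 1) (r-const 0))
    (λ x p → cong (λ n → if0 n 1 0) (m≤n⇒m∸n≡0 p))
    (λ x ¬p → no' (f x ∸ g x) (λ e → ¬p (m∸n≡0⇒m≤n e)))
    where
    no' : ∀ n → ¬ (n ≡ 0) → if0 n 1 0 ≡ 0
    no' zero h = ⊥-elim (h refl)
    no' (suc n) h = refl

  d-< : Rec A f → Rec A g → Dcd A (λ x → f x < g x)
  d-< r t = d-≤ (r-suc r) t

  d-≡ : Rec A f → Rec A g → Dcd A (λ x → f x ≡ g x)
  d-≡ r t = d-resp (λ x (p , p') → ≤-antisym p p') (λ x p → ≤-reflexive p , ≤-reflexive (sym p))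
                   (d-× (d-≤ r t) (d-≤ t r))

  d-⊤ : Dcd A (λ _ → ⊤)
  d-⊤ = d-char (r-const 1) (λ _ _ → refl) (λ _ k → ⊥-elim (k tt))

  d-b∃ : Rec A f → Dcd A (λ z → q (π₁ z) (π₂ z)) → Dcd A (λ x → ∃ λ n → n < f x × q x n)
  d-b∃ {f = f} {q = q} r d = d-char (r-natrec (r-const 0) step r)
      (λ x p → yes' x (f x) p) (λ x ¬p → no' x (f x) ¬p)
    where
    val : ℕ → ℕ → ℕ
    val x n = natrec 0 (λ k y → if0 y (χ (q x k)) 1) n
    step = r-if0 (r-π₂ v0) (r-χ (d-∘₂ {q = q} d (r-π₁ r-id) (r-π₁ v0))) (r-const 1)
    yes' : ∀ x n → (∃ λ k → k < n × q x k) → val x n ≡ 1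
    no' : ∀ x n → ¬ (∃ λ k → k < n × q x k) → val x n ≡ 0
    yes' x (suc n) (k , s≤s k≤n , qk) with em {∃ λ k → k < n × q x k}
    ... | yes p rewrite yes' x n p = refl
    ... | no ¬p rewrite no' x n ¬p with m≤n⇒m<n∨m≡n k≤n
    ...   | inj₁ k<n = ⊥-elim (¬p (k , k<n , qk))
    ...   | inj₂ refl = χ-yes qk
    no' x zero ¬p = refl
    no' x (suc n) ¬p rewrite no' x n (λ (k , k<n , qk) → ¬p (k , m≤n⇒m≤1+n k<n , qk)) =
      χ-no (λ qn → ¬p (n , ≤-refl , qn))

  d-b∀ : Rec A f → Dcd A (λ z → q (π₁ z) (π₂ z)) → Dcd A (λ x → ∀ n → n < f x → q x n)
  d-b∀ r d = d-resp
    (λ x k n n< → byContra λ ¬q → k (n , n< , ¬q))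
    (λ x k (n , n< , ¬q) → ¬q (k n n<))
    (d-¬ (d-b∃ r (d-¬ d)))

  -- Unbounded search.

  least-below : (Q : ℕ → Set) → ∀ n → (∃ λ m → Q m × (∀ k → k < m → ¬ Q k)) ⊎ (∀ k → k < n → ¬ Q k)
  least-below Q zero = inj₂ λ _ ()
  least-below Q (suc n) with least-below Q n
  ... | inj₁ p = inj₁ p
  ... | inj₂ h with em {Q n}
  ...   | yes q = inj₁ (n , q , h)
  ...   | no ¬q = inj₂ λ k k≤n → [ h k , (λ { refl → ¬q }) ]′ (m≤n⇒m<n∨m≡n (≤-pred k≤n))

  least : (Q : ℕ → Set) → ∃ Q → ∃ λ m → Q m × (∀ k → k < m → ¬ Q k)
  least Q (n , q) with least-below Q (suc n)
  ... | inj₁ p = p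
  ... | inj₂ h = ⊥-elim (h n ≤-refl q)

  opaque
    -- 0 when the predicate is empty.
    min : (ℕ → Set) → ℕ
    min Q with em {∃ Q}
    ... | yes p = proj₁ (least Q p)
    ... | no _  = 0

    min-least : (Q : ℕ → Set) → ∃ Q → Q (min Q) × (∀ k → k < min Q → ¬ Q k)
    min-least Q p with em {∃ Q}
    ... | yes p' = proj₂ (least Q p')
    ... | no ¬p = ⊥-elim (¬p p)

  min-∈ : (Q : ℕ → Set) → ∃ Q → Q (min Q)
  min-∈ Q p = proj₁ (min-least Q p)

  search : Dcd A (λ z → q (π₁ z) (π₂ z)) → Code
  search d = Mc (prog (r-χ (d-¬ d)))

  search-test : (d : Dcd A (λ z → q (π₁ z) (π₂ z))) → ∀ x n →
                Eval A (prog (r-χ (d-¬ d))) (pair x n) (χ (¬ q x n))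
  search-test {A} {q} d x n =
    subst₂ (λ a b → Eval A (prog (r-χ (d-¬ d))) (pair x n) (χ (¬ q a b)))
      (trans (π₁-fst _) (fst-pair x n)) (trans (π₂-snd _) (snd-pair x n))
      (run (r-χ (d-¬ d)) (pair x n))

  search-run : (d : Dcd A (λ z → q (π₁ z) (π₂ z))) → ∀ x → ∃ (q x) → Eval A (search {q = q} d) x (min (q x))
  search-run {A} {q} d x p = ev-M {x = x} {n = min (q x)} (to (χ-no (λ ¬q → ¬q (proj₁ l))) (search-test {q = q} d x _))
                                  (λ m m< → 0 , to (χ-yes (proj₂ l m m<)) (search-test {q = q} d x m))
    where
    l = min-least (q x) p
    to : ∀ {c n y y'} → y ≡ y' → Eval A c (pair x n) y → Eval A c (pair x n) y'
    to refl e = e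

  search-inv : (d : Dcd A (λ z → q (π₁ z) (π₂ z))) → ∀ x y → Eval A (search {q = q} d) x y → ∃ (q x)
  search-inv {q = q} d x y (ev-M e _) =
    y , byContra (χ-inv0 (sym (Eval-det e refl (search-test {q = q} d x y))))

  r-min : Dcd A (λ z → q (π₁ z) (π₂ z)) → (∀ x → ∃ (q x)) → Rec A (λ x → min (q x))
  r-min {q = q} d p = rec (search {q = q} d) (λ x → search-run {q = q} d x (p x))

  -- Counting the default as a solution when there is no other makes the search total, so it is
  -- recursive in any oracle that decides both `Q` and its nonemptiness.
  leastOr : ℕ → (ℕ → Set) → ℕ
  leastOr d Q = min (λ n → Q n ⊎ (¬ ∃ Q × n ≡ d))

  leastOr-total : ∀ d (Q : ℕ → Set) → ∃ λ n → Q n ⊎ (¬ ∃ Q × n ≡ d)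
  leastOr-total d Q with em {∃ Q}
  ... | yes (n , q) = n , inj₁ q
  ... | no ¬p = d , inj₂ (¬p , refl)

  leastOr-spec : ∀ d (Q : ℕ → Set) → Q (leastOr d Q) ⊎ (¬ ∃ Q × leastOr d Q ≡ d)
  leastOr-spec d Q = min-∈ _ (leastOr-total d Q)

  leastOr-∈ : ∀ d (Q : ℕ → Set) → ∃ Q → Q (leastOr d Q)
  leastOr-∈ d Q p with leastOr-spec d Q
  ... | inj₁ q = q
  ... | inj₂ (¬p , _) = ⊥-elim (¬p p)

  r-leastOr : Rec A f → Dcd A (λ z → q (π₁ z) (π₂ z)) → Dcd A (λ x → ∃ (q x)) →
              Rec A (λ x → leastOr (f x) (q x))
  r-leastOr {f = f} {q = q} r d e =
    r-min {q = λ x n → q x n ⊎ (¬ ∃ (q x) × n ≡ f x)} (d-⊎ d (d-× (d-∘ (d-¬ e) (r-π₁ r-id)) (d-≡ v0 (r ↑)))) (λ x → leastOr-total (f x) (q x))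

  -- The parameter theorem, the jump, and transitivity of reducibility.

  opaque
    -- The s-m-n function: this program ignores its input and runs `c` on the constant `x`.
    index : Code → ℕ → ℕ
    index c x = encode (Cc c (constCode x))

    r-index : ∀ c → Rec A f → Rec A (λ x → index c (f x))
    r-index {f = f} c r =
      rec-ext (λ x → cong (λ k → ⟨ 7 , ⟨ encode c , k ⟩ ⟩) (eq (f x)))
        (r-⟨⟩ (r-const 7) (r-⟨⟩ (r-const (encode c))
          (r-natrec (r-const (encode Zc)) (r-⟨⟩ (r-const 7) (r-⟨⟩ (r-const (encode Sc)) (r-π₂ v0))) r)))
      where
      eq : ∀ n → natrec (encode Zc) (λ _ y → ⟨ 7 , ⟨ encode Sc , y ⟩ ⟩) n ≡ encode (constCode n)
      eq zero = refl
      eq (suc n) = cong (λ k → ⟨ 7 , ⟨ encode Sc , k ⟩ ⟩) (eq n)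

    index-eval : ∀ c x {y z} → Eval A c x y → Φ (index c x) A z y
    index-eval {A} c x {y} {z} e =
      subst (λ d → Eval A d z y) (sym (decode-encode (Cc c (constCode x)))) (ev-C (constCode-run x) e)

    index-inv : ∀ c x {y z} → Φ (index c x) A z y → Eval A c x y
    index-inv {A} c x {y} {z} e with subst (λ d → Eval A d z y) (decode-encode (Cc c (constCode x))) e
    ... | ev-C k e' with Eval-det k refl (constCode-run x)
    ...   | refl = e'

  d-oracle : Dcd A A
  d-oracle = dcd Oc (λ _ → ev-O1) (λ _ → ev-O0)

  -- The indexed program ignores its input, so it halts on its own index exactly when the search for
  -- `n` succeeds. One query to the jump settles a Σ₁ statement.
  d-∃ : Dcd A (λ z → q (π₁ z) (π₂ z)) → Dcd (A ′) (λ x → ∃ (q x))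
  d-∃ {A} {q} d = d-resp
    (λ x (y , e) → search-inv {q = q} d x y (index-inv (search {q = q} d) x e))
    (λ x p → min (q x) , index-eval (search {q = q} d) x (search-run {q = q} d x p))
    (d-∘ d-oracle (r-index (search {q = q} d) r-id))

  d-∀ : Dcd A (λ z → q (π₁ z) (π₂ z)) → Dcd (A ′) (λ x → ∀ n → q x n)
  d-∀ {q = q} d = d-resp (λ x h n → byContra λ ¬q → h (n , ¬q)) (λ x h (n , ¬q) → ¬q (h n))
    (d-¬ (d-∃ {q = λ x n → ¬ q x n} (d-¬ d)))

  -- Substituting a decision procedure for oracle calls is composition of reductions.
  plug : Code → Code → Code
  plug o Zc = Zc
  plug o Sc = Sc
  plug o Ic = Ic
  plug o Oc = o
  plug o Fc = Fc
  plug o Dc = Dc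
  plug o (Pc f g) = Pc (plug o f) (plug o g)
  plug o (Cc f g) = Cc (plug o f) (plug o g)
  plug o (Rc f g) = Rc (plug o f) (plug o g)
  plug o (Mc f) = Mc (plug o f)

  plug-run : (d : Dcd A B) → ∀ {c x y} → Eval B c x y → Eval A (plug (test d) c) x y
  plug-run d ev-Z = ev-Z
  plug-run d ev-S = ev-S
  plug-run d ev-I = ev-I
  plug-run d (ev-O1 a) = pos d _ a
  plug-run d (ev-O0 a) = neg d _ a
  plug-run d ev-F = ev-F
  plug-run d ev-D = ev-D
  plug-run d (ev-P p q) = ev-P (plug-run d p) (plug-run d q)
  plug-run d (ev-C p q) = ev-C (plug-run d p) (plug-run d q)
  plug-run d (ev-R0 {x = x} p) = ev-R0 {x = x} (plug-run d p)
  plug-run d (ev-RS {x = x} {n = n} p q) = ev-RS {x = x} {n = n} (plug-run d p) (plug-run d q)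
  plug-run d (ev-M {x = x} {n = n} p h) = ev-M {x = x} {n = n} (plug-run d p) (λ m m<n → proj₁ (h m m<n) , plug-run d (proj₂ (h m m<n)))

  r-via : Dcd A B → Rec B f → Rec A f
  r-via d r = rec (plug (test d) (prog r)) λ x → plug-run d (run r x)

  d-via : Dcd A B → Dcd B Q → Dcd A Q
  d-via d e = dcd (plug (test d) (test e)) (λ x q → plug-run d (pos e x q)) (λ x q → plug-run d (neg e x q))

  d-jump : Dcd (A ′) A
  d-jump {A} = d-resp (λ x (_ , a) → a) (λ x a → 0 , a) (d-∃ {q = λ x _ → A x} (d-∘ d-oracle (r-π₁ r-id)))

-- Finite lists and finite certificates of computations.

module Certificates (em : ExcludedMiddle 0ℓ) where

  open Computability em

  private variable
    A : Pred
    f g h : ℕ → ℕ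
    q : ℕ → ℕ → Set

  nth : ℕ → ℕ → ℕ
  nth x l = π₁ (natrec l (λ _ → π₂) x)

  nth-cons : ∀ x a l → nth (suc x) ⟨ a , l ⟩ ≡ nth x l
  nth-cons x a l = cong π₁ (go x)
    where
    go : ∀ x → natrec ⟨ a , l ⟩ (λ _ → π₂) (suc x) ≡ natrec l (λ _ → π₂) x
    go zero = π₂-⟨⟩ a l
    go (suc x) = cong π₂ (go x)

  nth-≤ : ∀ x l → nth x l ≤ l
  nth-≤ x l = ≤-trans (π₁-≤ _) (go x)
    where
    go : ∀ x → natrec l (λ _ → π₂) x ≤ l
    go zero = ≤-refl
    go (suc x) = ≤-trans (π₂-≤ _) (go x)

  tab : (ℕ → ℕ) → ℕ → ℕ
  tab f zero = 0
  tab f (suc m) = ⟨ f 0 , tab (f ∘ suc) m ⟩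

  nth-tab : ∀ f m x → x < m → nth x (tab f m) ≡ f x
  nth-tab f (suc m) zero _ = π₁-⟨⟩ _ _
  nth-tab f (suc m) (suc x) (s≤s p) = trans (nth-cons x _ _) (nth-tab (f ∘ suc) m x p)

  -- Bounds the code of every table of length `m` with entries at most `b`, so that quantifiers over
  -- such tables are bounded.
  tab-bound : ℕ → ℕ → ℕ
  tab-bound b m = natrec 0 (λ _ y → ⟨ b , y ⟩) m

  tab-≤ : ∀ f b m → (∀ x → x < m → f x ≤ b) → tab f m ≤ tab-bound b m
  tab-≤ f b zero h = z≤n
  tab-≤ f b (suc m) h = ⟨⟩-mono (h 0 (s≤s z≤n)) (tab-≤ (f ∘ suc) b m (λ x p → h (suc x) (s≤s p)))

  r-nth : Rec A f → Rec A g → Rec A (λ x → nth (f x) (g x))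
  r-nth r t = r-π₁ (r-natrec t (r-π₂ (r-π₂ v0)) r)

  r-tab-bound : Rec A f → Rec A g → Rec A (λ x → tab-bound (f x) (g x))
  r-tab-bound r t = r-natrec (r-const 0) (r-⟨⟩ ((r ↑)) (r-π₂ v0)) t

  -- A finite list is coded as ⟨ length , nested pairs ⟩.
  Mem : ℕ → ℕ → Set
  Mem i D = ∃ λ x → x < π₁ D × nth x (π₂ D) ≡ i

  All : (ℕ → Set) → ℕ → Set
  All Q D = ∀ x → x < π₁ D → Q (nth x (π₂ D))

  All-elim : ∀ {Q D i} → All Q D → Mem i D → Q i
  All-elim h (x , x< , refl) = h x x<

  All-intro : ∀ {Q D} → (∀ i → Mem i D → Q i) → All Q D
  All-intro h x x< = h _ (x , x< , refl)

  Mem-≤ : ∀ {i D} → Mem i D → i ≤ D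
  Mem-≤ {D = D} (x , _ , refl) = ≤-trans (nth-≤ x (π₂ D)) (π₂-≤ D)

  d-Mem : Rec A f → Rec A g → Dcd A (λ x → Mem (f x) (g x))
  d-Mem r t = d-b∃ (r-π₁ t) (d-≡ (r-nth v0 (r-π₂ t ↑)) (r ↑))

  d-All : Dcd A (λ z → q (π₁ z) (π₂ z)) → Rec A f → Dcd A (λ x → All (q x) (f x))
  d-All {q = q} d r = d-b∀ (r-π₁ r) (d-∘₂ {q = q} d (r-π₁ r-id) (r-nth v0 (r-π₂ r ↑)))

  list : ℕ → (ℕ → ℕ) → ℕ
  list n f = ⟨ n , tab f n ⟩

  cons : ℕ → ℕ → ℕ
  cons i D = ⟨ suc (π₁ D) , ⟨ i , π₂ D ⟩ ⟩

  r-cons : Rec A f → Rec A g → Rec A (λ x → cons (f x) (g x))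
  r-cons r t = r-⟨⟩ (r-suc (r-π₁ t)) (r-⟨⟩ r (r-π₂ t))

  Mem-here : ∀ {i D} → Mem i (cons i D)
  Mem-here {i} {D} = 0 , subst (0 <_) (sym (π₁-⟨⟩ _ _)) (s≤s z≤n) ,
    trans (cong (nth 0) (π₂-⟨⟩ _ _)) (π₁-⟨⟩ _ _)

  Mem-there : ∀ {i j D} → Mem i D → Mem i (cons j D)
  Mem-there (x , p , refl) = suc x , subst (suc x <_) (sym (π₁-⟨⟩ _ _)) (s≤s p) ,
    trans (cong (nth (suc x)) (π₂-⟨⟩ _ _)) (nth-cons x _ _)

  Mem-cons⁻ : ∀ {i j D} → Mem i (cons j D) → i ≡ j ⊎ Mem i D
  Mem-cons⁻ (zero , p , refl) = inj₁ (trans (cong (nth 0) (π₂-⟨⟩ _ _)) (π₁-⟨⟩ _ _))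
  Mem-cons⁻ (suc x , p , refl) = inj₂ (x , ≤-pred (subst (suc x <_) (π₁-⟨⟩ _ _) p) ,
    sym (trans (cong (nth (suc x)) (π₂-⟨⟩ _ _)) (nth-cons x _ _)))

  Mem-nil : ∀ {i} → ¬ Mem i 0
  Mem-nil (x , p , _) with subst (x <_) (proj₁ π-zero) p
  ... | ()

  -- The first list comes out reversed, which is harmless because only membership is ever used.
  append : ℕ → ℕ → ℕ
  append D E = natrec E (λ x → cons (nth x (π₂ D))) (π₁ D)

  Mem-appendʳ : ∀ {i} D {E} → Mem i E → Mem i (append D E)
  Mem-appendʳ {i} D {E} p = go (π₁ D)
    where
    go : ∀ n → Mem i (natrec E (λ x → cons (nth x (π₂ D))) n)
    go zero = p
    go (suc n) = Mem-there (go n)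

  Mem-appendˡ : ∀ {i D} E → Mem i D → Mem i (append D E)
  Mem-appendˡ {D = D} E (x , x< , refl) = go (π₁ D) x<
    where
    go : ∀ n → x < n → Mem (nth x (π₂ D)) (natrec E (λ x → cons (nth x (π₂ D))) n)
    go (suc n) (s≤s p) with m≤n⇒m<n∨m≡n p
    ... | inj₁ x<n = Mem-there (go n x<n)
    ... | inj₂ refl = Mem-here

  Mem-append⁻ : ∀ {i} D E → Mem i (append D E) → Mem i D ⊎ Mem i E
  Mem-append⁻ {i} D E p = go (π₁ D) ≤-refl p
    where
    go : ∀ n → n ≤ π₁ D → Mem i (natrec E (λ x → cons (nth x (π₂ D))) n) → Mem i D ⊎ Mem i E
    go zero _ m = inj₂ m
    go (suc n) n< m with Mem-cons⁻ m
    ... | inj₁ refl = inj₁ (n , n< , refl)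
    ... | inj₂ m' = go n (<⇒≤ n<) m'

  All-append : ∀ {Q} D E → All Q D → All Q E → All Q (append D E)
  All-append {Q} D E p q = All-intro λ i m → [ All-elim {Q} p , All-elim {Q} q ]′ (Mem-append⁻ D E m)

  -- Decides a predicate defined by matching on a number, one constructor at a time. The successor
  -- case is asked for all recursive `g` because it is applied to the predecessor of `f`.
  d-case : ∀ {q : ℕ → ℕ → Set} → Rec A f → Dcd A (q 0) →
           (∀ {g} → Rec A g → Dcd A (λ x → q (suc (g x)) x)) → Dcd A (λ x → q (f x) x)
  d-case {A} {f} {q} r z s = d-resp (λ x → to (f x)) (λ x → from (f x))
    (d-⊎ (d-× (d-≡ r (r-const 0)) z) (d-× (d-≤ (r-const 1) r) (s (r-pred r))))
    where
    to : ∀ n {x} → (n ≡ 0 × q 0 x) ⊎ (1 ≤ n × q (suc (pred n)) x) → q n x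
    to zero (inj₁ (_ , p)) = p
    to (suc n) (inj₂ (_ , p)) = p
    from : ∀ n {x} → q n x → (n ≡ 0 × q 0 x) ⊎ (1 ≤ n × q (suc (pred n)) x)
    from zero p = inj₁ (refl , p)
    from (suc n) p = inj₂ (s≤s z≤n , p)

  -- A computation is certified by a finite list of ranked facts ⟨ t , ⟨ e , ⟨ x , y ⟩ ⟩ ⟩,
  -- "program e maps x to y", each justified by facts of smaller rank.
  In : ℕ → ℕ → ℕ → ℕ → ℕ → Set
  In w t e x y = Mem ⟨ t , ⟨ e , ⟨ x , y ⟩ ⟩ ⟩ w

  Have : ℕ → ℕ → ℕ → ℕ → ℕ → Set
  Have w t e x y = ∃ λ t' → t' < t × In w t' e x y

  -- Clause n is the evaluation rule of the constructor with tag n. The oracle clause is trivial, so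
  -- validity does not mention an oracle; the recorded answers are constrained by `Agree` alone.
  Rule : ℕ → ℕ → ℕ → ℕ → ℕ → ℕ → Set
  Rule w t e x y 0 = y ≡ 0
  Rule w t e x y 1 = y ≡ suc x
  Rule w t e x y 2 = y ≡ x
  Rule w t e x y 3 = ⊤
  Rule w t e x y 4 = y ≡ π₁ x
  Rule w t e x y 5 = y ≡ π₂ x
  Rule w t e x y 6 = Have w t (π₁ (π₂ e)) x (π₁ y) × Have w t (π₂ (π₂ e)) x (π₂ y)
  Rule w t e x y 7 = ∃ λ z → Have w t (π₂ (π₂ e)) x z × Have w t (π₁ (π₂ e)) z y
  Rule w t e x y 8 =
    (π₂ x ≡ 0 × Have w t (π₁ (π₂ e)) (π₁ x) y) ⊎
    (1 ≤ π₂ x × ∃ λ z → Have w t e ⟨ π₁ x , pred (π₂ x) ⟩ z ×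
                        Have w t (π₂ (π₂ e)) ⟨ π₁ x , ⟨ pred (π₂ x) , z ⟩ ⟩ y)
  Rule w t e x y 9 =
    Have w t (π₂ e) ⟨ x , y ⟩ 0 × (∀ m → m < y → ∃ λ k → Have w t (π₂ e) ⟨ x , m ⟩ (suc k))
  Rule w t e x y (suc (suc (suc (suc (suc (suc (suc (suc (suc (suc _)))))))))) = y ≡ 0

  Justified : ℕ → ℕ → Set
  Justified w E = Rule w (π₁ E) (π₁ (π₂ E)) (π₁ (π₂ (π₂ E))) (π₂ (π₂ (π₂ E))) (π₁ (π₁ (π₂ E)))

  Valid : ℕ → Set
  Valid w = All (Justified w) w

  -- Positive and negative oracle answers are tested by separate predicates, because a finite
  -- string, or a certificate for a jump, gives different kinds of evidence for the two.
  AgreeAt : (P N : ℕ → Set) → ℕ → Set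
  AgreeAt P N E = π₁ (π₁ (π₂ E)) ≡ 3 →
    (π₂ (π₂ (π₂ E)) ≡ 1 × P (π₁ (π₂ (π₂ E)))) ⊎ (π₂ (π₂ (π₂ E)) ≡ 0 × N (π₁ (π₂ (π₂ E))))

  ∁ : Pred → Pred
  ∁ X x = ¬ X x

  Agree : (P N : ℕ → Set) → ℕ → Set
  Agree P N = All (AgreeAt P N)

  Halts : ℕ → ℕ → Set
  Halts w e = ∃ λ y → ∃ λ t → In w t e e y

  d-In : ∀ {w t e x y : ℕ → ℕ} → Rec A w → Rec A t → Rec A e → Rec A x → Rec A y →
         Dcd A (λ z → In (w z) (t z) (e z) (x z) (y z))
  d-In w t e x y = d-Mem (r-⟨⟩ t (r-⟨⟩ e (r-⟨⟩ x y))) w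

  d-Have : ∀ {w t e x y : ℕ → ℕ} → Rec A w → Rec A t → Rec A e → Rec A x → Rec A y →
           Dcd A (λ z → Have (w z) (t z) (e z) (x z) (y z))
  d-Have w t e x y = d-b∃ t (d-In (w ↑) v0 (e ↑) (x ↑) (y ↑))

  In-≤ : ∀ {w t e x y} → In w t e x y → t ≤ w × y ≤ w
  In-≤ {w} {t} {e} {x} {y} p =
    subst (_≤ w) (π₁-⟨⟩ _ _) (≤-trans (π₁-≤ _) E≤) ,
    subst (_≤ w) (trans (cong (λ z → π₂ (π₂ z)) (π₂-⟨⟩ _ _)) (trans (cong π₂ (π₂-⟨⟩ _ _)) (π₂-⟨⟩ _ _)))
      (≤-trans (π₂-≤ _) (≤-trans (π₂-≤ _) (≤-trans (π₂-≤ _) E≤)))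
    where E≤ = Mem-≤ p

  d-∃≤ : Rec A f → (∀ x n → q x n → n ≤ f x) → Dcd A (λ z → q (π₁ z) (π₂ z)) → Dcd A (λ x → ∃ (q x))
  d-∃≤ r b d = d-resp (λ x (n , _ , p) → n , p) (λ x (n , p) → n , s≤s (b x n p) , p) (d-b∃ (r-suc r) d)

  d-Rule : ∀ {w t e x y n : ℕ → ℕ} → Rec A w → Rec A t → Rec A e → Rec A x → Rec A y → Rec A n →
           Dcd A (λ z → Rule (w z) (t z) (e z) (x z) (y z) (n z))
  d-Rule {A} {w} {t} {e} {x} {y} rw rt re rx ry rn =
    d-case {q = λ n z → R z n} rn (d-≡ ry (r-const 0)) λ r →
    d-case {q = λ n z → R z (1 + n)} r (d-≡ ry (r-suc rx)) λ r →
    d-case {q = λ n z → R z (2 + n)} r (d-≡ ry rx) λ r →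
    d-case {q = λ n z → R z (3 + n)} r d-⊤ λ r →
    d-case {q = λ n z → R z (4 + n)} r (d-≡ ry (r-π₁ rx)) λ r →
    d-case {q = λ n z → R z (5 + n)} r (d-≡ ry (r-π₂ rx)) λ r →
    d-case {q = λ n z → R z (6 + n)} r
      (d-× (d-Have rw rt (r-π₁ (r-π₂ re)) rx (r-π₁ ry)) (d-Have rw rt (r-π₂ (r-π₂ re)) rx (r-π₂ ry))) λ r →
    d-case {q = λ n z → R z (7 + n)} r
      (d-∃≤ rw (λ { _ _ ((_ , _ , p) , _) → proj₂ (In-≤ p) })
        (d-× (d-Have (rw ↑) (rt ↑) (r-π₂ (r-π₂ re) ↑) (rx ↑) v0)
             (d-Have (rw ↑) (rt ↑) (r-π₁ (r-π₂ re) ↑) v0 (ry ↑)))) λ r →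
    d-case {q = λ n z → R z (8 + n)} r
      (d-⊎ (d-× (d-≡ (r-π₂ rx) (r-const 0)) (d-Have rw rt (r-π₁ (r-π₂ re)) (r-π₁ rx) ry))
           (d-× (d-≤ (r-const 1) (r-π₂ rx))
             (d-∃≤ rw (λ { _ _ ((_ , _ , p) , _) → proj₂ (In-≤ p) })
               (d-× (d-Have (rw ↑) (rt ↑) (re ↑) (r-⟨⟩ (r-π₁ rx) (r-pred (r-π₂ rx)) ↑) v0)
                    (d-Have (rw ↑) (rt ↑) (r-π₂ (r-π₂ re) ↑)
                      (r-⟨⟩ (r-π₁ rx ↑) (r-⟨⟩ (r-pred (r-π₂ rx) ↑) v0)) (ry ↑)))))) λ r →
    d-case {q = λ n z → R z (9 + n)} r
      (d-× (d-Have rw rt (r-π₂ re) (r-⟨⟩ rx ry) (r-const 0))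
           (d-b∀ ry (d-∃≤ (rw ↑) (λ { _ _ (_ , _ , p) → ≤-trans (n≤1+n _) (proj₂ (In-≤ p)) })
             (d-Have (rw ↑ ↑) (rt ↑ ↑) (r-π₂ re ↑ ↑) (r-⟨⟩ (rx ↑ ↑) v1) (r-suc v0))))) λ r →
    d-≡ ry (r-const 0)
    where
    R : ℕ → ℕ → Set
    R z = Rule (w z) (t z) (e z) (x z) (y z)

  d-Valid : Rec A f → Dcd A (λ x → Valid (f x))
  d-Valid {f = f} r = d-All {q = λ z → Justified (f z)} (d-Rule (r ↑) (r-π₁ v0) (r-π₁ (r-π₂ v0)) (r-π₁ (r-π₂ (r-π₂ v0)))
                            (r-π₂ (r-π₂ (r-π₂ v0))) (r-π₁ (r-π₁ (r-π₂ v0)))) r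

  d-Agree : ∀ {P N : ℕ → ℕ → Set} → Dcd A (λ z → P (π₁ z) (π₂ z)) → Dcd A (λ z → N (π₁ z) (π₂ z)) →
            Rec A f → Dcd A (λ x → Agree (P x) (N x) (f x))
  d-Agree {P = P} {N} p n r = d-All {q = λ z → AgreeAt (P z) (N z)}
    (d-→ (d-≡ (r-π₁ (r-π₁ (r-π₂ v0))) (r-const 3))
      (d-⊎ (d-× (d-≡ y (r-const 1)) (d-∘₂ {q = P} p (r-π₁ r-id) x))
           (d-× (d-≡ y (r-const 0)) (d-∘₂ {q = N} n (r-π₁ r-id) x)))) r
    where
    x : ∀ {A} → Rec A (λ z → π₁ (π₂ (π₂ (π₂ z))))
    x = r-π₁ (r-π₂ (r-π₂ v0))
    y : ∀ {A} → Rec A (λ z → π₂ (π₂ (π₂ (π₂ z))))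
    y = r-π₂ (r-π₂ (r-π₂ v0))

  d-Halts : Rec A f → Rec A g → Dcd A (λ x → Halts (f x) (g x))
  d-Halts r t = d-∃≤ r (λ { _ _ (_ , p) → proj₂ (In-≤ p) })
    (d-∃≤ (r ↑) (λ { _ _ p → proj₁ (In-≤ p) }) (d-In (r ↑ ↑) v0 (t ↑ ↑) (t ↑ ↑) v1))

  entry-elim : ∀ {w t e x y} (Q : ℕ → Set) (R : ℕ → ℕ → ℕ → ℕ → Set) →
               (∀ E → Q E → R (π₁ E) (π₁ (π₂ E)) (π₁ (π₂ (π₂ E))) (π₂ (π₂ (π₂ E)))) →
               All Q w → In w t e x y → R t e x y
  entry-elim {w} {t} {e} {x} {y} Q R h a m = go (h _ (All-elim {Q} a m))
    where
    go : R (π₁ ⟨ t , ⟨ e , ⟨ x , y ⟩ ⟩ ⟩) (π₁ (π₂ ⟨ t , ⟨ e , ⟨ x , y ⟩ ⟩ ⟩))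
           (π₁ (π₂ (π₂ ⟨ t , ⟨ e , ⟨ x , y ⟩ ⟩ ⟩))) (π₂ (π₂ (π₂ ⟨ t , ⟨ e , ⟨ x , y ⟩ ⟩ ⟩))) → R t e x y
    go r rewrite π₁-⟨⟩ t ⟨ e , ⟨ x , y ⟩ ⟩ | π₂-⟨⟩ t ⟨ e , ⟨ x , y ⟩ ⟩ | π₁-⟨⟩ e ⟨ x , y ⟩ | π₂-⟨⟩ e ⟨ x , y ⟩
               | π₁-⟨⟩ x y | π₂-⟨⟩ x y = r

  entry-intro : ∀ t e x y (R : ℕ → ℕ → ℕ → ℕ → Set) → R t e x y →
                let E = ⟨ t , ⟨ e , ⟨ x , y ⟩ ⟩ ⟩ in
                R (π₁ E) (π₁ (π₂ E)) (π₁ (π₂ (π₂ E))) (π₂ (π₂ (π₂ E)))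
  entry-intro t e x y R r rewrite π₁-⟨⟩ t ⟨ e , ⟨ x , y ⟩ ⟩ | π₂-⟨⟩ t ⟨ e , ⟨ x , y ⟩ ⟩ | π₁-⟨⟩ e ⟨ x , y ⟩
    | π₂-⟨⟩ e ⟨ x , y ⟩ | π₁-⟨⟩ x y | π₂-⟨⟩ x y = r

  Valid-at : ∀ {w t e x y} → Valid w → In w t e x y → Rule w t e x y (π₁ e)
  Valid-at {w} = entry-elim (Justified w) (λ t e x y → Rule w t e x y (π₁ e)) (λ _ r → r)

  AgreeAt′ : (P N : ℕ → Set) → ℕ → ℕ → ℕ → Set
  AgreeAt′ P N e x y = π₁ e ≡ 3 → (y ≡ 1 × P x) ⊎ (y ≡ 0 × N x)

  Agree-at : ∀ {P N w t e x y} → Agree P N w → In w t e x y → AgreeAt′ P N e x y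
  Agree-at {P} {N} = entry-elim (AgreeAt P N) (λ _ → AgreeAt′ P N) (λ _ r → r)

  -- A query occurring in `w` is a component of the code `w`, so only numbers up to `w` matter.
  Agree-mono : ∀ P N P' N' {w} → (∀ x → x ≤ w → P x → P' x) → (∀ x → x ≤ w → N x → N' x) →
               Agree P N w → Agree P' N' w
  Agree-mono P N P' N' {w} p n a i i< eq =
    [ (λ (y , z) → inj₁ (y , p _ x≤ z)) , (λ (y , z) → inj₂ (y , n _ x≤ z)) ]′ (a i i< eq)
    where x≤ = ≤-trans (π₁-≤ _) (≤-trans (π₂-≤ _) (≤-trans (π₂-≤ _) (≤-trans (nth-≤ i _) (π₂-≤ w))))

  -- Soundness of certificates.

  module Sound {A : Pred} {w : ℕ} (v : Valid w) (a : Agree A (∁ A) w) where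

    run-rule : ∀ t e x y n → branch n (π₂ e) ≡ decode e → π₁ e ≡ n →
               (∀ {e' x' y'} → Have w t e' x' y' → Eval A (decode e') x' y') →
               AgreeAt′ A (∁ A) e x y → Rule w t e x y n → Eval A (branch n (π₂ e)) x y
    run-rule t e x y 0 c n ih o refl = ev-Z
    run-rule t e x y 1 c n ih o refl = ev-S
    run-rule t e x y 2 c n ih o refl = ev-I
    run-rule t e x y 3 c n ih o r with o n
    ... | inj₁ (refl , p) = ev-O1 p
    ... | inj₂ (refl , p) = ev-O0 p
    run-rule t e x y 4 c n ih o refl = subst (Eval A Fc x) (sym (π₁-fst x)) ev-F
    run-rule t e x y 5 c n ih o refl = subst (Eval A Dc x) (sym (π₂-snd x)) ev-D
    run-rule t e x y 6 c n ih o (p , q) =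
      subst (Eval A _ x) (trans (sym (⟨⟩-pair _ _)) (⟨⟩-η y)) (ev-P (ih p) (ih q))
    run-rule t e x y 7 c n ih o (z , p , q) = ev-C (ih p) (ih q)
    run-rule t e x y 8 c n ih o (inj₁ (z , p)) =
      subst (λ x → Eval A _ x y) (trans (cong (pair (π₁ x)) (sym z)) (trans (sym (⟨⟩-pair _ _)) (⟨⟩-η x)))
        (ev-R0 {x = π₁ x} (ih p))
    run-rule t e x y 8 c n ih o (inj₂ (1≤ , z , p , q)) =
      subst (λ x → Eval A _ x y) (trans (cong (pair (π₁ x)) (suc∘pred (π₂ x) 1≤)) (trans (sym (⟨⟩-pair _ _)) (⟨⟩-η x)))
        (ev-RS {x = π₁ x} {n = pred (π₂ x)}
          (subst₂ (λ c' x' → Eval A c' x' z) (sym c) (⟨⟩-pair _ _) (ih p))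
          (subst (λ x' → Eval A _ x' y) (trans (⟨⟩-pair (π₁ x) _) (cong (pair (π₁ x)) (⟨⟩-pair _ z))) (ih q)))
      where
      suc∘pred : ∀ n → 1 ≤ n → suc (pred n) ≡ n
      suc∘pred (suc n) _ = refl
    run-rule t e x y 9 c n ih o (p , q) =
      ev-M {x = x} {n = y} (subst (λ x' → Eval A _ x' 0) (⟨⟩-pair x y) (ih p))
           (λ m m< → let k , r = q m m< in k , subst (λ x' → Eval A _ x' (suc k)) (⟨⟩-pair x m) (ih r))
    run-rule t e x y (suc (suc (suc (suc (suc (suc (suc (suc (suc (suc _)))))))))) c n ih o refl = ev-Z

    -- Induction on the rank: a justification refers only to facts of smaller rank, which excludes
    -- circular certificates.
    sound : ∀ n t e x y → t < n → In w t e x y → Eval A (decode e) x y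
    sound (suc n) t e x y (s≤s t≤n) m = subst (λ c → Eval A c x y) (sym (decode-branch e))
      (run-rule t e x y (π₁ e) (sym (decode-branch e)) refl
        (λ (t' , t'<t , m') → sound n t' _ _ _ (≤-trans t'<t t≤n) m') (Agree-at a m) (Valid-at v m))

  -- Completeness of certificates.

  _⊆_ : ℕ → ℕ → Set
  w ⊆ w' = ∀ i → Mem i w → Mem i w'

  Have-mono : ∀ {w w' t t' e x y} → w ⊆ w' → t ≤ t' → Have w t e x y → Have w' t' e x y
  Have-mono s t≤ (t , t< , m) = t , ≤-trans t< t≤ , s _ m

  Rule-mono : ∀ {w w' t t'} e x y n → w ⊆ w' → t ≤ t' → Rule w t e x y n → Rule w' t' e x y n
  Rule-mono e x y 0 s t≤ r = r
  Rule-mono e x y 1 s t≤ r = r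
  Rule-mono e x y 2 s t≤ r = r
  Rule-mono e x y 3 s t≤ r = r
  Rule-mono e x y 4 s t≤ r = r
  Rule-mono e x y 5 s t≤ r = r
  Rule-mono e x y 6 s t≤ (p , q) = Have-mono s t≤ p , Have-mono s t≤ q
  Rule-mono e x y 7 s t≤ (z , p , q) = z , Have-mono s t≤ p , Have-mono s t≤ q
  Rule-mono e x y 8 s t≤ (inj₁ (z , p)) = inj₁ (z , Have-mono s t≤ p)
  Rule-mono e x y 8 s t≤ (inj₂ (l , z , p , q)) = inj₂ (l , z , Have-mono s t≤ p , Have-mono s t≤ q)
  Rule-mono e x y 9 s t≤ (p , h) = Have-mono s t≤ p , λ m m< → proj₁ (h m m<) , Have-mono s t≤ (proj₂ (h m m<))
  Rule-mono e x y (suc (suc (suc (suc (suc (suc (suc (suc (suc (suc _)))))))))) s t≤ r = r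

  Valid-append : ∀ {v w} → Valid v → Valid w → Valid (append v w)
  Valid-append {v} {w} p q = All-append {Justified (append v w)} v w
    (λ x x< → Rule-mono _ _ _ _ (λ i → Mem-appendˡ w) ≤-refl (p x x<))
    (λ x x< → Rule-mono _ _ _ _ (λ i → Mem-appendʳ v) ≤-refl (q x x<))

  data View (r : ℕ) : ℕ → Code → Set where
    vZ : View r 0 Zc
    vS : View r 1 Sc
    vI : View r 2 Ic
    vO : View r 3 Oc
    vF : View r 4 Fc
    vD : View r 5 Dc
    vP : View r 6 (Pc (decode (π₁ r)) (decode (π₂ r)))
    vC : View r 7 (Cc (decode (π₁ r)) (decode (π₂ r)))
    vR : View r 8 (Rc (decode (π₁ r)) (decode (π₂ r)))
    vM : View r 9 (Mc (decode r))
    vX : ∀ {t} → View r (10 + t) Zc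

  view : ∀ t r → View r t (branch t r)
  view 0 r = vZ
  view 1 r = vS
  view 2 r = vI
  view 3 r = vO
  view 4 r = vF
  view 5 r = vD
  view 6 r = vP
  view 7 r = vC
  view 8 r = vR
  view 9 r = vM
  view (suc (suc (suc (suc (suc (suc (suc (suc (suc (suc t)))))))))) r = vX

  module Complete (A : Pred) where

    -- `G` speaks of a list and a rank bound. Monotonicity in both is what allows certificates for
    -- several premises to be merged.
    Cert : (ℕ → ℕ → Set) → Set
    Cert G = ∃ λ w → ∃ λ t → Valid w × Agree A (∁ A) w × G w t

    Mono : (ℕ → ℕ → Set) → Set
    Mono G = ∀ {w w' t t'} → w ⊆ w' → t ≤ t' → G w t → G w' t'

    _⊗_ : ∀ {G H} → Mono G × Cert G → Mono H × Cert H → Mono (λ w t → G w t × H w t) × Cert (λ w t → G w t × H w t)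
    (mg , w , t , v , a , g) ⊗ (mh , w' , t' , v' , a' , h) =
      (λ s l (p , q) → mg s l p , mh s l q) ,
      append w w' , t + t' , Valid-append v v' , All-append {AgreeAt A (∁ A)} w w' a a' ,
      mg (λ i → Mem-appendˡ w') (m≤m+n t t') g , mh (λ i → Mem-appendʳ w) (m≤n+m t' t) h

    trivial : ∀ {G} → (∀ {w t} → G w t) → Mono G × Cert G
    trivial g = (λ _ _ _ → g) , 0 , 0 , (λ x x< → ⊥-elim (Mem-nil (x , x< , refl))) ,
                (λ x x< → ⊥-elim (Mem-nil (x , x< , refl))) , g

    -- The premises hold below rank `t`, so the concluded fact can be added with rank `t` itself.
    conclude : ∀ {e x y n} {G : ℕ → ℕ → Set} → π₁ e ≡ n → AgreeAt′ A (∁ A) e x y →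
               (∀ {w t} → G w t → Rule w t e x y n) → Mono G × Cert G →
               Mono (λ w t → Have w t e x y) × Cert (λ w t → Have w t e x y)
    conclude {e} {x} {y} refl o i (_ , w , t , v , a , g) =
      Have-mono , cons E w , suc t ,
      All-intro {Justified (cons E w)} (λ j m →
        [ (λ { refl → entry-intro t e x y (λ t e x y → Rule (cons E w) t e x y (π₁ e))
                        (Rule-mono e x y (π₁ e) step ≤-refl (i g)) })
        , (λ k → Rule-mono _ _ _ _ step ≤-refl (All-elim {Justified w} v k)) ]′ (Mem-cons⁻ m)) ,
      All-intro {AgreeAt A (∁ A)} (λ j m →
        [ (λ { refl → entry-intro t e x y (λ _ → AgreeAt′ A (∁ A)) o })
        , All-elim {AgreeAt A (∁ A)} a ]′ (Mem-cons⁻ m)) ,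
      t , ≤-refl , Mem-here
      where
      E = ⟨ t , ⟨ e , ⟨ x , y ⟩ ⟩ ⟩
      step : w ⊆ cons E w
      step i = Mem-there

    collect : (G : ℕ → ℕ → ℕ → Set) → ∀ n → (∀ m → m < n → Mono (G m) × Cert (G m)) →
              Mono (λ w t → ∀ m → m < n → G m w t) × Cert (λ w t → ∀ m → m < n → G m w t)
    collect G zero h = trivial λ _ ()
    collect G (suc n) h with collect G n (λ m m< → h m (m≤n⇒m≤1+n m<)) ⊗ h n ≤-refl
    ... | _ , w , t , v , a , f , g =
      (λ s l f m m< → proj₁ (h m m<) s l (f m m<)) ,
      w , t , v , a , λ m m< → [ f m , (λ { refl → g }) ]′ (m≤n⇒m<n∨m≡n (≤-pred m<))

    view-decode : ∀ e → View (π₂ e) (π₁ e) (decode e)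
    view-decode e = subst (View (π₂ e) (π₁ e)) (sym (decode-branch e)) (view (π₁ e) (π₂ e))

    not-oracle : ∀ {e x y n} → π₁ e ≡ n → ¬ (n ≡ 3) → AgreeAt′ A (∁ A) e x y
    not-oracle refl k z = ⊥-elim (k z)

    π₁-pair : ∀ a b → π₁ (pair a b) ≡ a
    π₁-pair a b = trans (cong π₁ (sym (⟨⟩-pair a b))) (π₁-⟨⟩ a b)

    π₂-pair : ∀ a b → π₂ (pair a b) ≡ b
    π₂-pair a b = trans (cong π₂ (sym (⟨⟩-pair a b))) (π₂-⟨⟩ a b)

    certify : ∀ {c x y} → Eval A c x y → ∀ {e n} → π₁ e ≡ n → View (π₂ e) n c →
              Mono (λ w t → Have w t e x y) × Cert (λ w t → Have w t e x y)
    certify ev-Z eq vZ = conclude eq (not-oracle eq λ ()) id (trivial refl)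
    certify ev-Z eq vX = conclude eq (not-oracle eq λ ()) id (trivial refl)
    certify ev-S eq vS = conclude eq (not-oracle eq λ ()) id (trivial refl)
    certify ev-I eq vI = conclude eq (not-oracle eq λ ()) id (trivial refl)
    certify (ev-O1 a) eq vO = conclude eq (λ _ → inj₁ (refl , a)) id (trivial tt)
    certify (ev-O0 a) eq vO = conclude eq (λ _ → inj₂ (refl , a)) id (trivial tt)
    certify {x = x} ev-F eq vF = conclude eq (not-oracle eq λ ()) id (trivial (sym (π₁-fst x)))
    certify {x = x} ev-D eq vD = conclude eq (not-oracle eq λ ()) id (trivial (sym (π₂-snd x)))
    certify {x = x} (ev-P {a = a} {b = b} p q) eq vP = conclude eq (not-oracle eq λ ())
      (λ (i , j) → subst (Have _ _ _ x) (sym (π₁-pair a b)) i , subst (Have _ _ _ x) (sym (π₂-pair a b)) j)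
      (certify p refl (view-decode _) ⊗ certify q refl (view-decode _))
    certify (ev-C {y = z} p q) eq vC = conclude eq (not-oracle eq λ ()) (λ (i , j) → z , i , j)
      (certify p refl (view-decode _) ⊗ certify q refl (view-decode _))
    certify {y = y} (ev-R0 {x = x} p) eq vR = conclude eq (not-oracle eq λ ())
      (λ i → inj₁ (π₂-pair x 0 , subst (λ x' → Have _ _ _ x' y) (sym (π₁-pair x 0)) i))
      (certify p refl (view-decode _))
    certify (ev-RS {x = x} {n = n} {y = z} {z = y} p q) {e} eq vR = conclude eq (not-oracle eq λ ())
      (λ (i , j) → inj₂ (subst (1 ≤_) (sym p₂) (s≤s z≤n) , z ,
         subst (λ x' → Have _ _ e x' z) (trans (sym (⟨⟩-pair x n)) (sym (cong₂ (λ u v → ⟨ u , pred v ⟩) p₁ p₂))) i ,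
         subst (λ x' → Have _ _ _ x' y)
           (trans (trans (cong (pair x) (sym (⟨⟩-pair n z))) (sym (⟨⟩-pair x ⟨ n , z ⟩)))
                  (sym (cong₂ (λ u v → ⟨ u , ⟨ pred v , z ⟩ ⟩) p₁ p₂))) j))
      (certify p eq vR ⊗ certify q refl (view-decode _))
      where
      p₁ = π₁-pair x (suc n)
      p₂ = π₂-pair x (suc n)
    certify (ev-M {x = x} {n = n} p h) {e} eq vM = conclude eq (not-oracle eq λ ())
      (λ (i , j) → subst (λ x' → Have _ _ (π₂ e) x' 0) (sym (⟨⟩-pair x n)) i ,
         λ m m< → let k , i' = j m m< in
                  k , subst (λ x' → Have _ _ (π₂ e) x' (suc k)) (sym (⟨⟩-pair x m)) i')
      (certify p refl (view-decode _) ⊗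
       collect (λ m w t → ∃ λ k → Have w t (π₂ e) (pair x m) (suc k)) n
         (λ m m< → some (certify (proj₂ (h m m<)) refl (view-decode _))))
      where
      some : ∀ {m k} → Mono (λ w t → Have w t (π₂ e) (pair x m) (suc k)) ×
                       Cert (λ w t → Have w t (π₂ e) (pair x m) (suc k)) →
             Mono (λ w t → ∃ λ k → Have w t (π₂ e) (pair x m) (suc k)) ×
             Cert (λ w t → ∃ λ k → Have w t (π₂ e) (pair x m) (suc k))
      some {k = k} (_ , w , t , v , a , i) = (λ s l (k , i) → k , Have-mono s l i) , w , t , v , a , k , i

  -- The Σ₂ normal form of the double jump.

  HaltsBy : ℕ → ℕ → Set
  HaltsBy e w = Valid w × Halts w e

  jump-cert : ∀ {A e} → (A ′) e → ∃ λ w → HaltsBy e w × Agree A (∁ A) w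
  jump-cert {A} {e} (y , p) with Complete.certify A p refl (Complete.view-decode A e)
  ... | _ , w , t , v , a , t' , _ , m = w , (v , y , t' , m) , a

  cert-jump : ∀ {A e w} → Valid w → Halts w e → Agree A (∁ A) w → (A ′) e
  cert-jump {e = e} v (y , t , m) a = y , Sound.sound v a (suc t) t e e y ≤-refl m

  d-HaltsBy : Rec A f → Rec A g → Dcd A (λ x → HaltsBy (f x) (g x))
  d-HaltsBy e w = d-× (d-Valid w) (d-Halts w e)

  -- Finite binary strings are coded as lists; entries other than 1 count as 0.
  _∋_ : ℕ → ℕ → Set
  σ ∋ x = nth x (π₂ σ) ≡ 1

  d-∋ : Rec A f → Rec A g → Dcd A (λ x → f x ∋ g x)
  d-∋ s x = d-≡ (r-nth x (r-π₂ s)) (r-const 1)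

  _⊑_ : ℕ → ℕ → Set
  σ ⊑ τ = π₁ σ ≤ π₁ τ × (∀ x → x < π₁ σ → (σ ∋ x → τ ∋ x) × (τ ∋ x → σ ∋ x))

  _≺_ : ℕ → Pred → Set
  σ ≺ X = ∀ x → x < π₁ σ → (σ ∋ x → X x) × (X x → σ ∋ x)

  prefix : Pred → ℕ → ℕ
  prefix X n = list n (λ x → χ (X x))

  prefix-≺ : ∀ X n → prefix X n ≺ X
  prefix-≺ X n x x< = (λ p → χ-inv (trans (sym bit) p)) , (λ p → trans bit (χ-yes p))
    where
    bit : nth x (π₂ (prefix X n)) ≡ χ (X x)
    bit = trans (cong (nth x) (π₂-⟨⟩ _ _)) (nth-tab _ n x (subst (x <_) (π₁-⟨⟩ _ _) x<))

  len-prefix : ∀ X n → π₁ (prefix X n) ≡ n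
  len-prefix X n = π₁-⟨⟩ _ _

  -- The first two need the string to be long enough to settle the bit; the last two only forbid a
  -- contrary bit and hold vacuously beyond its length.
  Has Lacks MayHave MayLack : ℕ → ℕ → Set
  Has σ x = x < π₁ σ × σ ∋ x
  Lacks σ x = x < π₁ σ × ¬ σ ∋ x
  MayHave σ x = x < π₁ σ → σ ∋ x
  MayLack σ x = x < π₁ σ → ¬ σ ∋ x

  AgreeStr : ℕ → ℕ → Set
  AgreeStr σ = Agree (Has σ) (Lacks σ)

  -- The string refutes the claim that `x` is outside the first jump. Bounding the certificate by
  -- the length keeps this decidable and monotone in the string.
  Refutes : ℕ → ℕ → Set
  Refutes σ x = ∃ λ w → w < suc (π₁ σ) × (HaltsBy x w × AgreeStr σ w)

  -- u = ⟨ w , v ⟩: w certifies the computation of the second jump, and v all the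
  -- computations of the first jump that w uses positively; σ has not refuted u.
  NR : ℕ → ℕ → ℕ → Set
  NR e u σ = HaltsBy e (π₁ u) × Valid (π₂ u) ×
    Agree (Halts (π₂ u)) (∁ (Refutes σ)) (π₁ u) ×
    Agree (MayHave σ) (MayLack σ) (π₂ u)

  d-NR : Rec A f → Rec A g → Rec A h → Dcd A (λ x → NR (f x) (g x) (h x))
  d-NR {f = f} {g = g} {h = h} e u σ =
    d-× (d-HaltsBy e (r-π₁ u)) (d-× (d-Valid (r-π₂ u)) (d-×
      (d-Agree {P = λ x → Halts (π₂ (g x))} {N = λ x y → ¬ Refutes (h x) y} (d-Halts (r-π₂ u ↑) v0)
        (d-¬ (d-b∃ (r-suc (r-π₁ σ ↑)) (d-× (d-HaltsBy v1 v0)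
          (d-Agree {P = λ z x → x < π₁ (h (π₁ (π₁ z))) × h (π₁ (π₁ z)) ∋ x}
                   {N = λ z x → x < π₁ (h (π₁ (π₁ z))) × ¬ (h (π₁ (π₁ z)) ∋ x)}
            (d-× (d-< v0 (r-π₁ σ ↑ ↑ ↑)) (d-∋ (σ ↑ ↑ ↑) v0))
            (d-× (d-< v0 (r-π₁ σ ↑ ↑ ↑)) (d-¬ (d-∋ (σ ↑ ↑ ↑) v0))) v0)))) (r-π₁ u))
      (d-Agree {P = λ z x → x < π₁ (h z) → h z ∋ x} {N = λ z x → x < π₁ (h z) → ¬ (h z ∋ x)}
        (d-→ (d-< v0 (r-π₁ σ ↑)) (d-∋ (σ ↑) v0))
        (d-→ (d-< v0 (r-π₁ σ ↑)) (d-¬ (d-∋ (σ ↑) v0))) (r-π₂ u))))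

  -- A longer string refutes more negative claims and leaves fewer bits open, so a witness once
  -- refuted stays refuted.
  NR-antitone : ∀ {e u σ τ} → σ ⊑ τ → NR e u τ → NR e u σ
  NR-antitone {e} {u} {σ} {τ} (l , s) (p , q , a , b) = p , q ,
    Agree-mono (Halts (π₂ u)) (∁ (Refutes τ)) (Halts (π₂ u)) (∁ (Refutes σ)) (λ _ _ k → k) (λ x _ ¬r (w , w< , hw , c) → ¬r (w , ≤-trans w< (s≤s l) , hw ,
      Agree-mono (Has σ) (Lacks σ) (Has τ) (Lacks τ)
        (λ x _ (x< , k) → ≤-trans x< l , proj₁ (s x x<) k)
                 (λ x _ (x< , k) → ≤-trans x< l , λ j → k (proj₂ (s x x<) j)) c)) a ,
    Agree-mono (MayHave τ) (MayLack τ) (MayHave σ) (MayLack σ)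
               (λ x _ k x< → proj₂ (s x x<) (k (≤-trans x< l)))
               (λ x _ k x< j → k (≤-trans x< l) (proj₁ (s x x<) j)) b

  module _ (X : Pred) where

    Halts-mono : ∀ {v w e} → v ⊆ w → Halts v e → Halts w e
    Halts-mono s (y , t , m) = y , t , s _ m

    -- Runs through the entries of `w` and appends a certificate for each queried number that lies
    -- in the jump of `X`. Negative answers have no finite certificate and stay as they are.
    collect-jump : ∀ w → Agree (X ′) (∁ (X ′)) w →
                   ∃ λ v → Valid v × Agree X (∁ X) v × Agree (Halts v) (∁ (X ′)) w
    collect-jump w a = go (π₁ w) ≤-refl
      where
      go : ∀ n → n ≤ π₁ w → ∃ λ v → Valid v × Agree X (∁ X) v ×
           (∀ i → i < n → AgreeAt (Halts v) (∁ (X ′)) (nth i (π₂ w)))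
      go zero _ = 0 , (λ x x< → ⊥-elim (Mem-nil (x , x< , refl))) ,
                  (λ x x< → ⊥-elim (Mem-nil (x , x< , refl))) , λ _ ()
      go (suc n) n< with go n (<⇒≤ n<) | em {(X ′) (π₁ (π₂ (π₂ (nth n (π₂ w)))))}
      ... | v , vv , av , aw | no ¬j = v , vv , av , λ i i< →
        [ aw i , (λ { refl eq → [ (λ (_ , j) → ⊥-elim (¬j j)) , inj₂ ]′ (a i n< eq) }) ]′ (m≤n⇒m<n∨m≡n (≤-pred i<))
      ... | v , vv , av , aw | yes j with jump-cert j
      ...   | v' , (vv' , h') , av' = append v v' , Valid-append vv vv' ,
        All-append {AgreeAt X (∁ X)} v v' av av' , λ i i< eq →
        [ (λ i<n → [ (λ (y , hx) → inj₁ (y , Halts-mono (λ _ → Mem-appendˡ v') hx)) , inj₂ ]′ (aw i i<n eq))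
        , (λ { refl → [ (λ (y , _) → inj₁ (y , Halts-mono (λ _ → Mem-appendʳ v) h')) , inj₂ ]′ (a i n< eq) })
        ]′ (m≤n⇒m<n∨m≡n (≤-pred i<))

    -- Half of the equivalence: `e` is in the double jump of `X` iff some `u` is refuted by no
    -- initial segment of `X`.
    double-jump-normal : ∀ {e} → ((X ′) ′) e → ∃ λ u → ∀ σ → σ ≺ X → NR e u σ
    double-jump-normal {e} j with jump-cert j
    ... | w , h , a with collect-jump w a
    ...   | v , vv , av , aw = ⟨ w , v ⟩ , λ σ σ≺X →
      subst₂ (λ w v → HaltsBy e w × Valid v × Agree (Halts v) (∁ (Refutes σ)) w ×
                      Agree (MayHave σ) (MayLack σ) v)
        (sym (π₁-⟨⟩ w v)) (sym (π₂-⟨⟩ w v))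
        (h , vv ,
         Agree-mono (Halts v) (∁ (X ′)) (Halts v) (∁ (Refutes σ)) (λ _ _ k → k) (λ x _ ¬j (w' , _ , (v' , h') , a') → ¬j (cert-jump v' h'
           (Agree-mono (Has σ) (Lacks σ) X (∁ X)
             (λ x _ (x< , k) → proj₁ (σ≺X x x<) k) (λ x _ (x< , k) i → k (proj₂ (σ≺X x x<) i)) a'))) aw ,
         Agree-mono X (∁ X) (MayHave σ) (MayLack σ)
           (λ x _ k x< → proj₂ (σ≺X x x<) k) (λ x _ k x< i → k (proj₁ (σ≺X x x<) i)) av)

    normal-double-jump : ∀ {e u} → (∀ σ → σ ≺ X → NR e u σ) → ((X ′) ′) e
    normal-double-jump {e} {u} nr = cert-jump (proj₁ halts) (proj₂ halts) λ i i< eq →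
        [ (λ (y , hx) → inj₁ (y , cert-jump vv hx av))
        , (λ (y , _) → inj₂ (y , unrefuted i i< eq y)) ]′ (answers 0 i i< eq)
      where
      at : ∀ n → NR e u (prefix X n)
      at n = nr _ (prefix-≺ X n)
      halts = proj₁ (at 0)
      v = π₂ u
      vv : Valid v
      vv = proj₁ (proj₂ (at 0))
      answers : ∀ n → Agree (Halts v) (∁ (Refutes (prefix X n))) (π₁ u)
      answers n = proj₁ (proj₂ (proj₂ (at n)))
      n<len : ∀ {x} n → x < n → x < π₁ (prefix X n)
      n<len n p = subst (_ <_) (sym (len-prefix X n)) p
      bit : ∀ w x → x ≤ w → (prefix X (suc w) ∋ x → X x) × (X x → prefix X (suc w) ∋ x)
      bit w x p = prefix-≺ X (suc w) x (n<len (suc w) (s≤s p))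
      av : Agree X (∁ X) v
      -- The queries in `v` are at most `v`, so the prefix of length `suc v` settles all of them.
      av = Agree-mono (MayHave (prefix X (suc v))) (MayLack (prefix X (suc v))) X (∁ X)
                      (λ x x≤ k → proj₁ (bit v x x≤) (k (n<len (suc v) (s≤s x≤))))
                      (λ x x≤ k i → k (n<len (suc v) (s≤s x≤)) (proj₂ (bit v x x≤) i))
                      (proj₂ (proj₂ (proj₂ (at (suc v)))))
      unrefuted : ∀ i → i < π₁ (π₁ u) → π₁ (π₁ (π₂ (nth i (π₂ (π₁ u))))) ≡ 3 →
                  π₂ (π₂ (π₂ (nth i (π₂ (π₁ u))))) ≡ 0 → ¬ (X ′) (π₁ (π₂ (π₂ (nth i (π₂ (π₁ u))))))
      -- If a number declared absent were in the jump, its certificate `w` would already be refuting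
      -- at the prefix of length `suc w`.
      unrefuted i i< eq y j with jump-cert j
      ... | w , hw , aw with answers (suc w) i i< eq
      ...   | inj₁ (y' , _) with trans (sym y) y'
      ...     | ()
      unrefuted i i< eq y j | w , hw , aw | inj₂ (_ , ¬r) =
        ¬r (w , s≤s (<⇒≤ (n<len (suc w) ≤-refl)) , hw ,
            Agree-mono X (∁ X) (Has (prefix X (suc w))) (Lacks (prefix X (suc w)))
                       (λ x x≤ k → n<len (suc w) (s≤s x≤) , proj₂ (bit w x x≤) k)
                       (λ x x≤ k → n<len (suc w) (s≤s x≤) , λ k' → k (proj₁ (bit w x x≤) k')) aw)

-- String extensions and smallness of finite intersections of classes.

module Largeness (em : ExcludedMiddle 0ℓ) where

  open Computability em
  open Certificates em

  private variable
    A : Pred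
    f g : ℕ → ℕ

  ⊑-refl : ∀ {σ} → σ ⊑ σ
  ⊑-refl = ≤-refl , λ _ _ → id , id

  ⊑-trans : ∀ {ρ σ τ} → ρ ⊑ σ → σ ⊑ τ → ρ ⊑ τ
  ⊑-trans (l , p) (l' , q) = ≤-trans l l' , λ x x< →
    (proj₁ (q x (≤-trans x< l)) ∘ proj₁ (p x x<)) , (proj₂ (p x x<) ∘ proj₂ (q x (≤-trans x< l)))

  -- The extension relation of Mathias forcing, with reservoir `Z`.
  Ext : ℕ → ℕ → Pred → Set
  Ext F τ Z = F ⊑ τ × (∀ x → x < π₁ τ → π₁ F ≤ x → τ ∋ x → Z x)

  Ext-refl : ∀ {F Z} → Ext F F Z
  Ext-refl = ⊑-refl , λ x x< ≤x → ⊥-elim (<⇒≱ x< ≤x)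

  Ext-mono : ∀ {F τ Y Z} → (∀ x → x < π₁ τ → Y x → Z x) → Ext F τ Y → Ext F τ Z
  Ext-mono i (p , q) = p , λ x x< ≤x b → i x x< (q x x< ≤x b)

  Ext-trans : ∀ {F σ τ Z} → Ext F σ Z → Ext σ τ Z → Ext F τ Z
  Ext-trans {F} {σ} {τ} {Z} (p , q) (p' , q') = ⊑-trans p p' , go
    where
    go : ∀ x → x < π₁ τ → π₁ F ≤ x → τ ∋ x → Z x
    go x x< ≤x b with ≤-<-connex (π₁ σ) x
    ... | inj₁ σ≤x = q' x x< σ≤x b
    ... | inj₂ x<σ = q x x<σ ≤x (proj₂ (proj₂ p' x x<σ) b)

  d-⊑ : Rec A f → Rec A g → Dcd A (λ x → f x ⊑ g x)
  d-⊑ r t = d-× (d-≤ (r-π₁ r) (r-π₁ t)) (d-b∀ (r-π₁ r)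
    (d-× (d-→ (d-∋ (r ↑) v0) (d-∋ (t ↑) v0)) (d-→ (d-∋ (t ↑) v0) (d-∋ (r ↑) v0))))

  d-Ext : ∀ {Z : ℕ → ℕ → Set} → Dcd A (λ z → Z (π₁ z) (π₂ z)) → Rec A f → Rec A g →
          Dcd A (λ x → Ext (f x) (g x) (Z x))
  d-Ext dZ r t = d-× (d-⊑ r t) (d-b∀ (r-π₁ t) (d-→ (d-≤ (r-π₁ r ↑) v0) (d-→ (d-∋ (t ↑) v0) dZ)))

  -- i = ⟨ e , ⟨ F , u ⟩ ⟩ names the upward closed class of all Y such that some extension
  -- of the string F inside Y refutes the witness u for membership of e in the double jump.
  Meets : Pred → ℕ → Set
  Meets Y i = ∃ λ τ → Ext (π₁ (π₂ i)) τ Y × ¬ NR (π₁ i) (π₂ (π₂ i)) τ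

  -- The stage `m` approximation of `Meets`. A code bounds the length of its string, so only the
  -- part of `Y` below `m` is consulted.
  MeetsBy : Pred → ℕ → ℕ → Set
  MeetsBy Y i m = ∃ λ τ → τ < suc m × Ext (π₁ (π₂ i)) τ Y × ¬ NR (π₁ i) (π₂ (π₂ i)) τ

  MeetsBy-mono : ∀ {Y Z i m n} → m ≤ n → (∀ x → x < m → Y x → Z x) → MeetsBy Y i m → MeetsBy Z i n
  MeetsBy-mono l s (τ , τ≤ , e , r) = τ , ≤-trans τ≤ (s≤s l) ,
    Ext-mono (λ x x< → s x (≤-trans x< (≤-trans (π₁-≤ τ) (≤-pred τ≤)))) e , r

  d-MeetsBy : ∀ {Y : ℕ → ℕ → Set} → Dcd A (λ z → Y (π₁ z) (π₂ z)) → Rec A f → Rec A g →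
              Dcd A (λ x → MeetsBy (Y x) (f x) (g x))
  d-MeetsBy {Y = Y} dY i m = d-b∃ (r-suc m) (d-×
    (d-Ext {Z = λ z → Y (π₁ z)} (d-∘₂ {q = Y} dY (r-π₁ (r-π₁ r-id)) v0) (r-π₁ (r-π₂ i) ↑) v0)
    (d-¬ (d-NR (r-π₁ i ↑) (r-π₂ (r-π₂ i) ↑) v0)))

  Class : Pred → (ℕ → ℕ) → ℕ → Pred
  Class Z c x y = Z y × c y ≡ c x

  -- w = ⟨ D , ⟨ k , b ⟩ ⟩: families D, number of colours k, lower bound b.
  BadAt : Pred → ℕ → ℕ → (ℕ → ℕ) → ℕ → Set
  BadAt Z w m c x = π₂ (π₂ w) ≤ x → Z x →
    ∃ λ j → j < π₁ (π₁ w) × ¬ MeetsBy (Class Z c x) (nth j (π₂ (π₁ w))) m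

  -- Level `m` of the tree of finite colourings. The prefix `p` of length `n` is carried along so
  -- that a branch can be built one colour at a time.
  Good : Pred → ℕ → ℕ → ℕ → ℕ → (ℕ → ℕ) → Set
  Good Z w p n m c = ∀ x → x < m → c x < π₁ (π₂ w) × (x < n → c x ≡ nth x p) × BadAt Z w m c x

  Extable : Pred → ℕ → ℕ → ℕ → Set
  Extable Z w p n = ∀ m → ∃ λ (c : ℕ → ℕ) → Good Z w p n m c

  -- By compactness: Z above b is a union of k classes each missing a family of D.
  Small : Pred → ℕ → Set
  Small Z w = Extable Z w 0 0

  Good-cong : ∀ {Z w p n m c c'} → (∀ x → x < m → c x ≡ c' x) → Good Z w p n m c → Good Z w p n m c'
  Good-cong {m = m} eq gd x x< with gd x x<
  ... | c< , agr , bad = subst (_< _) (eq x x<) c< , (λ l → trans (sym (eq x x<)) (agr l)) , λ b≤ z →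
    let j , j< , miss = bad b≤ z in j , j< , λ mt → miss (MeetsBy-mono ≤-refl
      (λ y y< (zy , cy) → zy , trans (eq y y<) (trans cy (sym (eq x x<)))) mt)

  Good-restrict : ∀ {Z w p n m m' c} → m ≤ m' → Good Z w p n m' c → Good Z w p n m c
  Good-restrict l gd x x< with gd x (≤-trans x< l)
  ... | c< , agr , bad = c< , agr , λ b≤ z →
    let j , j< , miss = bad b≤ z in j , j< , λ mt → miss (MeetsBy-mono l (λ _ _ → id) mt)

  d-Good : ∀ {Z : ℕ → ℕ → Set} {w p n m c : ℕ → ℕ} → Dcd A (λ z → Z (π₁ z) (π₂ z)) →
           Rec A w → Rec A p → Rec A n → Rec A m → Rec A c →
           Dcd A (λ z → Good (Z z) (w z) (p z) (n z) (m z) (λ y → nth y (c z)))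
  d-Good {Z = Z} {c = c} dZ w p n m rc = d-b∀ m
    (d-× (d-< (r-nth v0 (rc ↑)) (r-π₁ (r-π₂ w) ↑))
    (d-× (d-→ (d-< v0 (n ↑)) (d-≡ (r-nth v0 (rc ↑)) (r-nth v0 (p ↑))))
         (d-→ (d-≤ (r-π₂ (r-π₂ w) ↑) v0) (d-→ dZ
           (d-b∃ (r-π₁ (r-π₁ w) ↑) (d-¬ (d-MeetsBy
             {Y = λ z y → Z (π₁ (π₁ z)) y × nth y (c (π₁ (π₁ z))) ≡ nth (π₂ (π₁ z)) (c (π₁ (π₁ z)))}
             (d-× (d-∘₂ {q = Z} dZ (r-π₁ (r-π₁ (r-π₁ r-id))) v0)
                  (d-≡ (r-nth v0 (rc ↑ ↑ ↑)) (r-nth v2 (rc ↑ ↑ ↑))))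
             (r-nth v0 (r-π₂ (r-π₁ w) ↑ ↑)) (m ↑ ↑))))))))

  -- With `k` colours, a colouring below `m` is coded by a number at most `tab-bound k m`. The inner
  -- existential is therefore bounded and the whole statement is Π₁ in `A`.
  d-Extable : ∀ {Z : ℕ → ℕ → Set} {w p n : ℕ → ℕ} → Dcd A (λ z → Z (π₁ z) (π₂ z)) →
              Rec A w → Rec A p → Rec A n → Dcd (A ′) (λ z → Extable (Z z) (w z) (p z) (n z))
  d-Extable {A} {Z = Z} {w} {p} {n} dZ rw rp rn = d-resp decoded coded
    (d-∀ {q = Coded}
      (d-b∃ (r-suc (r-tab-bound (r-π₁ (r-π₂ rw) ↑) v0))
        (d-Good {Z = λ z → Z (π₁ (π₁ z))} (d-∘₂ {q = Z} dZ (r-π₁ (r-π₁ (r-π₁ r-id))) v0)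
          (rw ↑ ↑) (rp ↑ ↑) (rn ↑ ↑) v1 v0)))
    where
    Coded : ℕ → ℕ → Set
    Coded z m = ∃ λ c → c < suc (tab-bound (π₁ (π₂ (w z))) m) × Good (Z z) (w z) (p z) (n z) m (λ y → nth y c)
    decoded : ∀ z → (∀ m → Coded z m) → Extable (Z z) (w z) (p z) (n z)
    decoded z h m with h m
    ... | c , _ , gd = (λ y → nth y c) , gd
    coded : ∀ z → Extable (Z z) (w z) (p z) (n z) → ∀ m → Coded z m
    coded z h m with h m
    ... | c , gd = tab c m , s≤s (tab-≤ c _ m (λ x x< → <⇒≤ (proj₁ (gd x x<)))) ,
                   Good-cong (λ x x< → sym (nth-tab c m x x<)) gd

  -- König's lemma and the leftmost colouring.

  collect-bound : ∀ {P : ℕ → ℕ → Set} → (∀ {c m n} → m ≤ n → P c m → P c n) →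
                  ∀ k → (∀ c → c < k → ∃ (P c)) → ∃ λ m → ∀ c → c < k → P c m
  collect-bound up zero h = 0 , λ _ ()
  collect-bound up (suc k) h with collect-bound up k (λ c c< → h c (m≤n⇒m≤1+n c<)) | h k ≤-refl
  ... | m , a | n , b = m + n , λ c c< →
    [ (λ c<k → up (m≤m+n m n) (a c c<k)) , (λ { refl → up (m≤n+m n m) b }) ]′ (m≤n⇒m<n∨m≡n (≤-pred c<))

  override : ℕ → ℕ → ℕ → ℕ
  override p n c = tab (λ x → if0 (n ∸ x) c (nth x p)) (suc n)

  override-old : ∀ p n c x → x < n → nth x (override p n c) ≡ nth x p
  override-old p n c x x< = trans (nth-tab (λ x → if0 (n ∸ x) c (nth x p)) (suc n) x (m≤n⇒m≤1+n x<)) (go (n ∸ x) (m<n⇒0<n∸m x<))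
    where
    go : ∀ d → 0 < d → if0 d c (nth x p) ≡ nth x p
    go (suc d) _ = refl

  override-new : ∀ p n c → nth n (override p n c) ≡ c
  override-new p n c = trans (nth-tab (λ x → if0 (n ∸ x) c (nth x p)) (suc n) n ≤-refl) (cong (λ d → if0 d c (nth n p)) (n∸n≡0 n))

  -- The König step: if every colour for the point `n` failed at some level, all would fail at a
  -- common level `m`, against extendibility of `p` to a level beyond it.
  Extable-step : ∀ {Z w p n} → Extable Z w p n → ∃ λ q →
                 (∀ x → x < n → nth x q ≡ nth x p) × nth n q < π₁ (π₂ w) × Extable Z w q (suc n)
  Extable-step {Z} {w} {p} {n} ext = byContra λ none →
    let m , fail = collect-bound {P = λ c m → ¬ ∃ λ g → Good Z w (override p n c) (suc n) m g}
          (λ m≤m' ¬gd (g , gd) → ¬gd (g , Good-restrict m≤m' gd)) (π₁ (π₂ w))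
          (λ c c< → ¬∀⇒∃¬ λ e → none (override p n c , override-old p n c , subst (_< _) (sym (override-new p n c)) c< , e))
        -- This level is at least `m` and also high enough for `n` to be coloured.
        g , gd = ext (m + suc n)
    in fail (g n) (proj₁ (gd n (m≤n+m (suc n) m))) (g , Good-restrict (m≤m+n m (suc n)) λ x x< →
         let c< , agr , bad = gd x x< in c< , (λ x≤n →
           [ (λ x<n → trans (agr x<n) (sym (override-old p n (g n) x x<n))) , (λ { refl → sym (override-new p n (g n)) }) ]′
           (m≤n⇒m<n∨m≡n (≤-pred x≤n))) , bad)

  Everything : Pred
  Everything _ = ⊤

  -- The second alternative makes the search for `q` total even when `p` is not extendible.
  Continues : ℕ → ℕ → ℕ → ℕ → Set
  Continues w n p q =
    ((∀ x → x < n → nth x q ≡ nth x p) × nth n q < π₁ (π₂ w) × Extable Everything w q (suc n))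
    ⊎ ¬ Extable Everything w p n

  Continues-total : ∀ w n p → ∃ (Continues w n p)
  Continues-total w n p with em {Extable Everything w p n}
  ... | yes e = let q , c = Extable-step e in q , inj₁ c
  ... | no ¬e = 0 , inj₂ ¬e

  opaque
    path : ℕ → ℕ → ℕ
    path w = natrec 0 (λ n p → min (Continues w n p))

    path-zero : ∀ w → path w 0 ≡ 0
    path-zero w = refl

    path-suc : ∀ w n → path w (suc n) ≡ min (Continues w n (path w n))
    path-suc w n = refl

    path-natrec : ∀ w n → natrec 0 (λ n p → min (Continues w n p)) n ≡ path w n
    path-natrec w n = refl

  colour : ℕ → ℕ → ℕ
  colour w x = nth x (path w (suc x))

  -- On `Everything` extendibility is Π₁, so one jump computes the leftmost branch. With `A` empty,
  -- the colouring is ∅′-recursive uniformly in `w`, which keeps all reservoirs ∅′-recursive.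
  r-colour : Rec (A ′) f → Rec (A ′) g → Rec (A ′) (λ x → colour (f x) (g x))
  r-colour {A} {f} {g} r t = r-nth t (rec-ext (λ x → path-natrec (f x) (suc (g x))) (r-natrec {s = λ x n p → min (Continues (f x) n p)} (r-const 0)
    (r-min {q = λ z → Continues (f (π₁ z)) (π₁ (π₂ z)) (π₂ (π₂ z))}
      (d-⊎ (d-× (d-b∀ n (d-≡ (r-nth v0 v1) (r-nth v0 (p ↑))))
           (d-× (d-< (r-nth n v0) (r-π₁ (r-π₂ w)))
                (d-Ex w v0 (r-suc n))))
           (d-¬ (d-Ex w p n)))
      (λ z → Continues-total (f (π₁ z)) (π₁ (π₂ z)) (π₂ (π₂ z)))) (r-suc t)))
    where
    w : Rec (A ′) (λ z → f (π₁ (π₁ z)))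
    w = r ↑ ↑
    n : Rec (A ′) (λ z → π₁ (π₂ (π₁ z)))
    n = r-π₁ v0 ↑
    p : Rec (A ′) (λ z → π₂ (π₂ (π₁ z)))
    p = r-π₂ v0 ↑
    d-Ex : ∀ {w p n : ℕ → ℕ} → Rec (A ′) w → Rec (A ′) p → Rec (A ′) n →
           Dcd (A ′) (λ z → Extable Everything (w z) (p z) (n z))
    d-Ex {w} {p} {n} rw rp rn = d-resp (λ z → subst id (eq z)) (λ z → subst id (sym (eq z)))
      (d-∘ (d-Extable {Z = λ _ → Everything} {w = π₁} {p = λ z → π₁ (π₂ z)} {n = λ z → π₂ (π₂ z)}
             d-⊤ (r-π₁ r-id) (r-π₁ v0) (r-π₂ v0)) (r-⟨⟩ rw (r-⟨⟩ rp rn)))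
      where
      eq : ∀ z → Extable Everything (π₁ ⟨ w z , ⟨ p z , n z ⟩ ⟩) (π₁ (π₂ ⟨ w z , ⟨ p z , n z ⟩ ⟩)) (π₂ (π₂ ⟨ w z , ⟨ p z , n z ⟩ ⟩))
               ≡ Extable Everything (w z) (p z) (n z)
      eq z rewrite π₁-⟨⟩ (w z) ⟨ p z , n z ⟩ | π₂-⟨⟩ (w z) ⟨ p z , n z ⟩ | π₁-⟨⟩ (p z) (n z) | π₂-⟨⟩ (p z) (n z) = refl

  nth-zero : ∀ x → nth x 0 ≡ 0
  nth-zero x = n≤0⇒n≡0 (nth-≤ x 0)

  -- Not strict, since it must hold for every `w`: where extendibility fails the least continuation
  -- is 0, and its entries are 0 even if there are no colours at all.
  colour-≤ : ∀ w x → colour w x ≤ π₁ (π₂ w)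
  colour-≤ w x = subst (λ q → nth x q ≤ π₁ (π₂ w)) (sym (path-suc w x))
    (go (min-least _ (Continues-total w x (path w x))))
    where
    zero-least : ∀ m → (∀ j → j < m → ¬ Continues w x (path w x) j) → ¬ Extable Everything w (path w x) x → m ≡ 0
    zero-least zero _ _ = refl
    zero-least (suc m) h ¬e = ⊥-elim (h 0 (s≤s z≤n) (inj₂ ¬e))
    go : ∀ {q} → Continues w x (path w x) q × (∀ j → j < q → ¬ Continues w x (path w x) j) → nth x q ≤ π₁ (π₂ w)
    go (inj₁ (_ , c< , _) , _) = <⇒≤ c<
    go {q} (inj₂ ¬e , least) = subst (λ q → nth x q ≤ π₁ (π₂ w)) (sym (zero-least q least ¬e))
                                     (subst (_≤ π₁ (π₂ w)) (sym (nth-zero x)) z≤n)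

  module _ {w : ℕ} (small : Small Everything w) where

    path-extable : ∀ n → Extable Everything w (path w n) n
    path-next : ∀ n → (∀ x → x < n → nth x (path w (suc n)) ≡ nth x (path w n)) ×
                Extable Everything w (path w (suc n)) (suc n)
    path-extable zero = subst (λ p → Extable Everything w p 0) (sym (path-zero w)) small
    path-extable (suc n) = proj₂ (path-next n)
    path-next n = subst (λ q → (∀ x → x < n → nth x q ≡ nth x (path w n)) × Extable Everything w q (suc n))
      (sym (path-suc w n)) (go (min-∈ _ (Continues-total w n (path w n))))
      where
      go : ∀ {q} → Continues w n (path w n) q →
           (∀ x → x < n → nth x q ≡ nth x (path w n)) × Extable Everything w q (suc n)
      go (inj₁ (agr , _ , e)) = agr , e
      go (inj₂ ¬e) = ⊥-elim (¬e (path-extable n))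

    path-colour : ∀ n x → x < n → nth x (path w n) ≡ colour w x
    path-colour (suc n) x x≤n with m≤n⇒m<n∨m≡n (≤-pred x≤n)
    ... | inj₁ x<n = trans (proj₁ (path-next n) x x<n) (path-colour n x x<n)
    ... | inj₂ refl = refl

    colour-good : ∀ m → Good Everything w 0 0 m (colour w)
    colour-good m with path-extable m m
    ... | c , gd = λ x x< → let c< , _ , bad = gd' x x< in c< , (λ ()) , bad
      where
      gd' : Good Everything w (path w m) m m (colour w)
      gd' = Good-cong (λ x x< → trans (proj₁ (proj₂ (gd x x<)) x<) (path-colour m x x<)) gd

-- The greedy collection of triples.

module Greedy (em : ExcludedMiddle 0ℓ) (R : ℕ → Pred) (hR : seqSet R ≤T (∅ ′)) where

  open Computability em
  open Certificates em
  open Largeness em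

  private variable
    f g : ℕ → ℕ

  d-R : Rec (∅ ′) f → Rec (∅ ′) g → Dcd (∅ ′) (λ x → R (f x) (g x))
  d-R {f} {g} r t = d-resp (λ x → subst₂ R (p₁ x) (p₂ x)) (λ x → subst₂ R (sym (p₁ x)) (sym (p₂ x)))
    (d-∘ (fromT hR) (r-⟨⟩ r t))
    where
    p₁ : ∀ x → fst ⟨ f x , g x ⟩ ≡ f x
    p₁ x = trans (sym (π₁-fst _)) (π₁-⟨⟩ (f x) (g x))
    p₂ : ∀ x → snd ⟨ f x , g x ⟩ ≡ g x
    p₂ x = trans (sym (π₂-snd _)) (π₂-⟨⟩ (f x) (g x))

  opaque
    -- For γ = ⟨ n , w ⟩: the common refinement of R n and of the leftmost path for w.
    hue : ℕ → ℕ → ℕ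
    hue γ x = ⟨ χ (R (π₁ γ) x) , colour (π₂ γ) x ⟩

    r-hue : Rec (∅ ′) f → Rec (∅ ′) g → Rec (∅ ′) (λ x → hue (f x) (g x))
    r-hue r t = r-⟨⟩ (r-χ (d-R (r-π₁ r) t)) (r-colour (r-π₂ r) t)

    hue-≤ : ∀ γ x → hue γ x ≤ ⟨ 1 , π₁ (π₂ (π₂ γ)) ⟩
    hue-≤ γ x = ⟨⟩-mono χ-≤1 (colour-≤ (π₂ γ) x)

    hue-χ : ∀ γ x → π₁ (hue γ x) ≡ χ (R (π₁ γ) x)
    hue-χ γ x = π₁-⟨⟩ _ _

    hue-colour : ∀ γ x → π₂ (hue γ x) ≡ colour (π₂ γ) x
    hue-colour γ x = π₂-⟨⟩ _ _

  -- The reservoir described by a list of pairs ⟨ colouring , colour ⟩.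
  InL : ℕ → Pred
  InL Λ x = All (λ E → hue (π₁ E) x ≡ π₂ E) Λ

  d-InL : Dcd (∅ ′) (λ z → InL (π₁ z) (π₂ z))
  d-InL = d-All {q = λ z E → hue (π₁ E) (π₂ z) ≡ π₂ E} (d-≡ (r-hue (r-π₁ v0) v1) (r-π₂ v0)) (r-π₁ r-id)

  InL-head : ∀ {γ c Λ x} → InL (cons ⟨ γ , c ⟩ Λ) x → hue γ x ≡ c
  InL-head {γ} {c} {Λ} {x} h = trans (cong (λ γ → hue γ x) (sym (π₁-⟨⟩ γ c)))
    (trans (All-elim {λ E → hue (π₁ E) x ≡ π₂ E} h Mem-here) (π₂-⟨⟩ γ c))

  InL-tail : ∀ {E Λ x} → InL (cons E Λ) x → InL Λ x
  InL-tail {x = x} h = All-intro λ E m → All-elim {λ E → hue (π₁ E) x ≡ π₂ E} h (Mem-there m)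

  InL-cons : ∀ {γ c Λ x} → hue γ x ≡ c → InL Λ x → InL (cons ⟨ γ , c ⟩ Λ) x
  InL-cons {γ} {c} {Λ} {x} p h = All-intro λ E m →
    [ (λ { refl → trans (cong (λ γ → hue γ x) (π₁-⟨⟩ γ c)) (trans p (sym (π₂-⟨⟩ γ c))) })
    , All-elim {λ E → hue (π₁ E) x ≡ π₂ E} h ]′ (Mem-cons⁻ m)

  InL-nil : ∀ {x} → InL 0 x
  InL-nil x x< = ⊥-elim (Mem-nil (x , x< , refl))

  -- κ = ⟨ e , ⟨ F , Λ ⟩ ⟩ names the families ⟨ e , ⟨ τ , u ⟩ ⟩ with τ extending F inside Λ, u arbitrary.
  Fam : ℕ → ℕ → Set
  Fam κ i = π₁ i ≡ π₁ κ × Ext (π₁ (π₂ κ)) (π₁ (π₂ i)) (InL (π₂ (π₂ κ)))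

  InC : ℕ → ℕ → Set
  InC K i = ∃ λ j → j < π₁ K × Fam (nth j (π₂ K)) i

  d-InC : Rec (∅ ′) f → Rec (∅ ′) g → Dcd (∅ ′) (λ x → InC (f x) (g x))
  d-InC {f} K i = d-b∃ (r-π₁ K) (d-× (d-≡ (r-π₁ i ↑) (r-π₁ κ))
    (d-Ext {Z = λ z → InL (π₂ (π₂ (nth (π₂ z) (π₂ (f (π₁ z))))))}
      (d-∘₂ {q = InL} d-InL (r-π₂ (r-π₂ (r-nth v1 (r-π₂ K ↑ ↑)))) v0)
      (r-π₁ (r-π₂ κ)) (r-π₁ (r-π₂ i) ↑)))
    where
    κ : Rec (∅ ′) (λ z → nth (π₂ z) (π₂ (f (π₁ z))))
    κ = r-nth v0 (r-π₂ K ↑)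

  InC-mono : ∀ {K K' i} → K ⊆ K' → InC K i → InC K' i
  InC-mono {i = i} s (j , j< , fm) with s _ (j , j< , refl)
  ... | j' , j'< , eq = j' , j'< , subst (λ κ → Fam κ i) (sym eq) fm

  InC-cons⁻ : ∀ {κ K i} → InC (cons κ K) i → Fam κ i ⊎ InC K i
  InC-cons⁻ {i = i} (j , j< , fm) with Mem-cons⁻ (j , j< , refl)
  ... | inj₁ eq = inj₁ (subst (λ κ → Fam κ i) eq fm)
  ... | inj₂ (j' , j'< , eq) = inj₂ (j' , j'< , subst (λ κ → Fam κ i) (sym eq) fm)

  Mem-InC : ∀ {κ K i} → Mem κ K → Fam κ i → InC K i
  Mem-InC (j , j< , refl) fm = j , j< , fm

  -- `w` shows that finitely many families named by `K` have a non-large intersection. This is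
  -- decidable in ∅′, hence `Rej` is decidable in ∅″.
  RejBy : ℕ → ℕ → Set
  RejBy K w = All (InC K) (π₁ w) × Small Everything w

  Rej : ℕ → Set
  Rej K = ∃ (RejBy K)

  d-RejBy : Rec (∅ ′) f → Rec (∅ ′) g → Dcd (∅ ′) (λ x → RejBy (f x) (g x))
  d-RejBy {f} K w = d-×
    (d-All {q = λ x → InC (f x)} (d-InC (K ↑) v0) (r-π₁ w))
    (d-∘ (d-Extable {A = ∅} {Z = λ _ → Everything} {w = λ x → x} {p = λ _ → 0} {n = λ _ → 0}
            d-⊤ r-id (r-const 0) (r-const 0)) w)

  up : Rec (∅ ′) f → Rec ((∅ ′) ′) f
  up = r-via d-jump

  d-Rej : Rec ((∅ ′) ′) f → Dcd ((∅ ′) ′) (λ x → Rej (f x))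
  d-Rej K = d-∘ (d-∃ {q = RejBy} (d-RejBy (r-π₁ r-id) v0)) K

  opaque
    -- Triples are treated in the order of their codes, so stage `s` decides about the triple coded
    -- by `s`.
    greedy : ℕ → ℕ
    greedy = natrec 0 (λ s K → if0 (χ (Rej (cons s K))) (cons s K) K)

    r-greedy : Rec ((∅ ′) ′) f → Rec ((∅ ′) ′) (λ x → greedy (f x))
    r-greedy = r-natrec {s = λ _ s K → if0 (χ (Rej (cons s K))) (cons s K) K} (r-const 0)
      (r-if0 (r-χ (d-Rej c)) c (r-π₂ v0))
      where
      c : Rec ((∅ ′) ′) (λ z → cons (π₁ (π₂ z)) (π₂ (π₂ z)))
      c = r-cons (r-π₁ v0) (r-π₂ v0)

    greedy-zero : greedy 0 ≡ 0
    greedy-zero = refl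

    greedy-rej : ∀ {s} → Rej (cons s (greedy s)) → greedy (suc s) ≡ greedy s
    greedy-rej {s} r = cong (λ n → if0 n (cons s (greedy s)) (greedy s)) (χ-yes r)

    greedy-acc : ∀ {s} → ¬ Rej (cons s (greedy s)) → greedy (suc s) ≡ cons s (greedy s)
    greedy-acc {s} r = cong (λ n → if0 n (cons s (greedy s)) (greedy s)) (χ-no r)

  ¬Rej-nil : ¬ Rej 0
  -- Level b + 1, where b is the lower bound in `w`, colours the point b; its class would have to
  -- miss a family, but there is none.
  ¬Rej-nil (w , inc , small) with small (suc (π₂ (π₂ w)))
  ... | c , gd with proj₂ (proj₂ (gd (π₂ (π₂ w)) ≤-refl)) ≤-refl tt
  ...   | j , j< , _ with inc j j<
  ...     | j' , j'< , _ = Mem-nil (j' , j'< , refl)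

  ¬Rej-greedy : ∀ s → ¬ Rej (greedy s)
  ¬Rej-greedy zero = subst (λ K → ¬ Rej K) (sym greedy-zero) ¬Rej-nil
  ¬Rej-greedy (suc s) with em {Rej (cons s (greedy s))}
  ... | yes r = subst (λ K → ¬ Rej K) (sym (greedy-rej r)) (¬Rej-greedy s)
  ... | no ¬r = subst (λ K → ¬ Rej K) (sym (greedy-acc ¬r)) ¬r

  greedy-step : ∀ s → greedy s ⊆ greedy (suc s)
  greedy-step s i m with em {Rej (cons s (greedy s))}
  ... | yes r = subst (Mem i) (sym (greedy-rej r)) m
  ... | no ¬r = subst (Mem i) (sym (greedy-acc ¬r)) (Mem-there m)

  greedy-mono : ∀ {s t} → s ≤ t → greedy s ⊆ greedy t
  greedy-mono {s} {zero} z≤n i m = m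
  greedy-mono {s} {suc t} s≤ i m with m≤n⇒m<n∨m≡n s≤
  ... | inj₁ s< = greedy-step t i (greedy-mono (≤-pred s<) i m)
  ... | inj₂ refl = m

  -- Alive reservoirs: those large relative to the greedy collection.

  Small-resp : ∀ {Z Z' w} → (∀ x → Z x → Z' x) → (∀ x → Z' x → Z x) → Small Z w → Small Z' w
  Small-resp i j h m with h m
  ... | c , gd = c , λ x x< → let c< , agr , bad = gd x x< in c< , agr , λ b≤ z' →
    let l , l< , miss = bad b≤ (j x z') in
    l , l< , λ mt → miss (MeetsBy-mono ≤-refl (λ y _ (z , e) → j y z , e) mt)

  -- v = ⟨ s , w ⟩.
  Covers : Pred → ℕ → Set
  Covers Z v = All (InC (greedy (π₁ v))) (π₁ (π₂ v)) × Small Z (π₂ v)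

  Alive : ℕ → Set
  Alive Λ = ∀ v → ¬ Covers (InL Λ) v

  -- The reservoir is ∅′-recursive, so smallness of it is Π₁(∅′). Hence `Alive` is Π₁(∅″), which is
  -- what a PA function over ∅″ can handle.
  d-Covers : Rec ((∅ ′) ′) f → Rec ((∅ ′) ′) g → Dcd ((∅ ′) ′) (λ x → Covers (InL (f x)) (g x))
  d-Covers {f} {g} Λ v = d-×
    (d-All {q = λ x → InC (greedy (π₁ (g x)))}
      (d-∘₂ {q = InC} (d-via d-jump (d-InC (r-π₁ r-id) v0)) (r-greedy (r-π₁ v ↑)) v0)
      (r-π₁ (r-π₂ v)))
    (d-∘₂ {q = λ Λ w → Small (InL Λ) w}
      (d-Extable {Z = λ z → InL (π₁ z)} {w = π₂} {p = λ _ → 0} {n = λ _ → 0}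
        (d-∘₂ {q = InL} d-InL (r-π₁ (r-π₁ r-id)) v0) v0 (r-const 0) (r-const 0)) Λ (r-π₂ v))

  witness : ℕ → ℕ → ℕ → ℕ → ℕ
  witness s D k b = ⟨ s , ⟨ D , ⟨ k , b ⟩ ⟩ ⟩

  Covers-intro : ∀ {Z} s D k b → All (InC (greedy s)) D →
    (∀ m → ∃ λ (c : ℕ → ℕ) → ∀ x → x < m → c x < k ×
      (b ≤ x → Z x → ∃ λ i → Mem i D × ¬ MeetsBy (Class Z c x) i m)) → Covers Z (witness s D k b)
  Covers-intro {Z} s D k b inc h
    rewrite π₁-⟨⟩ s ⟨ D , ⟨ k , b ⟩ ⟩ | π₂-⟨⟩ s ⟨ D , ⟨ k , b ⟩ ⟩ | π₁-⟨⟩ D ⟨ k , b ⟩ | π₂-⟨⟩ D ⟨ k , b ⟩ =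
    inc , λ m → let c , gd = h m in c , λ x x< → let c< , bad = gd x x< in
      subst (c x <_) (sym (π₁-⟨⟩ k b)) c< , (λ ()) , λ b≤ z → found D m c x (bad (subst (_≤ x) (π₂-⟨⟩ k b) b≤) z)
    where
    found : ∀ D' m c x → (∃ λ i → Mem i D' × ¬ MeetsBy (Class Z c x) i m) →
            ∃ λ j → j < π₁ D' × ¬ MeetsBy (Class Z c x) (nth j (π₂ D')) m
    found D' m c x (i , (j , j< , eq) , miss) = j , j< , subst (λ i → ¬ MeetsBy (Class Z c x) i m) (sym eq) miss

  Covers-elim : ∀ {Z v} → Covers Z v → ∃ λ s → ∃ λ D → ∃ λ k → ∃ λ b → All (InC (greedy s)) D ×
    (∀ m → ∃ λ (c : ℕ → ℕ) → ∀ x → x < m → c x < k ×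
      (b ≤ x → Z x → ∃ λ i → Mem i D × ¬ MeetsBy (Class Z c x) i m))
  Covers-elim (inc , small) = _ , _ , _ , _ , inc , λ m → let c , gd = small m in c , λ x x< →
    let c< , _ , bad = gd x x< in c< , λ b≤ z → let j , j< , miss = bad b≤ z in _ , (j , j< , refl) , miss

  Alive-nil : Alive 0
  Alive-nil v (inc , small) = ¬Rej-greedy (π₁ v) (π₂ v , inc , Small-resp (λ _ _ → tt) (λ _ _ → InL-nil) small)

  -- A reservoir empty above `b` would be covered by one colour and no families.
  Alive-infinite : ∀ {Λ} → Alive Λ → ∀ b → ∃ λ x → b ≤ x × InL Λ x
  Alive-infinite alive b = byContra λ none → alive _
    (Covers-intro 0 0 1 b (λ x x< → ⊥-elim (Mem-nil (x , x< , refl)))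
      λ m → (λ _ → 0) , λ x x< → s≤s z≤n , λ b≤ z → ⊥-elim (none (x , b≤ , z)))

  -- Otherwise the single family `i` and the constant colouring would cover the reservoir.
  Alive-meets : ∀ {Λ s i} → Alive Λ → InC (greedy s) i → Meets (InL Λ) i
  Alive-meets {Λ} {s} {i} alive inc = byContra λ miss → alive _
    (Covers-intro s (cons i 0) 1 0
      (All-intro {InC (greedy s)} λ j m → [ (λ { refl → inc }) , (λ m' → ⊥-elim (Mem-nil m')) ]′ (Mem-cons⁻ m))
      λ m → (λ _ → 0) , λ x x< → s≤s z≤n , λ _ z → i , Mem-here ,
        λ (τ , _ , e , r) → miss (τ , Ext-mono (λ _ _ → proj₁) e , r))

  -- Shifting the second palette by `k` keeps points of `Y` and the other points in different
  -- classes. Each joint class lies in a class of one of the covers and misses the same family.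
  Covers-union : ∀ {Y Z W : Pred} {u v} → (∀ x → W x → Y x ⊎ Z x) → Covers Y u → Covers Z v → ∃ (Covers W)
  Covers-union {Y} {Z} {W} split cy cz with Covers-elim cy | Covers-elim cz
  ... | s , D , k , b , inc , h | s' , D' , k' , b' , inc' , h' = _ ,
    Covers-intro (s + s') (append D D') (k + k') (b + b')
      (All-append {InC (greedy (s + s'))} D D' (λ x x< → InC-mono (greedy-mono (m≤m+n s s')) (inc x x<))
                                               (λ x x< → InC-mono (greedy-mono (m≤n+m s' s)) (inc' x x<)))
      cover
    where
    join : (ℕ → ℕ) → (ℕ → ℕ) → ℕ → ℕ
    join c c' x = if0 (χ (Y x)) (k + c' x) (c x)
    join-yes : ∀ c c' {x} → Y x → join c c' x ≡ c x
    join-yes c c' {x} y = cong (λ n → if0 n (k + c' x) (c x)) (χ-yes y)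
    join-no : ∀ c c' {x} → ¬ Y x → join c c' x ≡ k + c' x
    join-no c c' {x} ¬y = cong (λ n → if0 n (k + c' x) (c x)) (χ-no ¬y)
    cover : ∀ m → ∃ λ (c : ℕ → ℕ) → ∀ x → x < m → c x < k + k' ×
      (b + b' ≤ x → W x → ∃ λ i → Mem i (append D D') × ¬ MeetsBy (Class W c x) i m)
    cover m with h m | h' m
    ... | c , gd | c' , gd' = join c c' , go
      where
      separate : ∀ {x y} → y < m → c y ≡ k + c' x → ⊥
      separate {x} {y} y< eq = <⇒≱ (proj₁ (gd y y<)) (≤-trans (m≤m+n k (c' x)) (≤-reflexive (sym eq)))
      go : ∀ x → x < m → join c c' x < k + k' ×
           (b + b' ≤ x → W x → ∃ λ i → Mem i (append D D') × ¬ MeetsBy (Class W (join c c') x) i m)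
      go x x< with em {Y x}
      ... | yes yx = subst (_< k + k') (sym (join-yes c c' yx)) (≤-trans (proj₁ (gd x x<)) (m≤m+n k k')) , λ b≤ _ →
        let i , mi , miss = proj₂ (gd x x<) (≤-trans (m≤m+n b b') b≤) yx in
        i , Mem-appendˡ D' mi , λ mt → miss (MeetsBy-mono ≤-refl inside mt)
        where
        inside : ∀ y → y < m → Class W (join c c') x y → Class Y c x y
        inside y y< (wy , eq) with em {Y y}
        ... | yes yy = yy , trans (sym (join-yes c c' yy)) (trans eq (join-yes c c' yx))
        ... | no ¬yy = ⊥-elim (separate x< (trans (sym (join-yes c c' yx)) (trans (sym eq) (join-no c c' ¬yy))))
      ... | no ¬yx = subst (_< k + k') (sym (join-no c c' ¬yx)) (+-monoʳ-< k (proj₁ (gd' x x<))) , λ b≤ wx →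
        let i , mi , miss = proj₂ (gd' x x<) (≤-trans (m≤n+m b' b) b≤) ([ (λ yx → ⊥-elim (¬yx yx)) , id ]′ (split x wx)) in
        i , Mem-appendʳ D mi , λ mt → miss (MeetsBy-mono ≤-refl inside mt)
        where
        inside : ∀ y → y < m → Class W (join c c') x y → Class Z c' x y
        inside y y< (wy , eq) with em {Y y}
        ... | yes yy = ⊥-elim (separate y< (trans (sym (join-yes c c' yy)) (trans eq (join-no c c' ¬yx))))
        ... | no ¬yy = [ (λ yy → ⊥-elim (¬yy yy)) , id ]′ (split y wy) ,
                       +-cancelˡ-≡ k _ _ (trans (sym (join-no c c' ¬yy)) (trans eq (join-no c c' ¬yx)))

  -- If every cell were covered, the finitely many covers would unite to a cover of the whole
  -- reservoir.
  Alive-split : ∀ {Λ} → Alive Λ → ∀ γ → ∃ λ c → c ≤ ⟨ 1 , π₁ (π₂ (π₂ γ)) ⟩ × Alive (cons ⟨ γ , c ⟩ Λ)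
  Alive-split {Λ} alive γ = byContra λ none →
    let v , cov = below none (suc β) ≤-refl in
    -- All hues are at most β, so at `suc β` the restriction on the hue is void.
    alive v (proj₁ cov , Small-resp (λ _ → proj₁) (λ x z → z , s≤s (hue-≤ γ x)) (proj₂ cov))
    where
    β = ⟨ 1 , π₁ (π₂ (π₂ γ)) ⟩
    below : ¬ (∃ λ c → c ≤ β × Alive (cons ⟨ γ , c ⟩ Λ)) → ∀ n → n ≤ suc β →
            ∃ (Covers (λ x → InL Λ x × hue γ x < n))
    below none zero _ = _ , Covers-intro 0 0 1 0 (λ x x< → ⊥-elim (Mem-nil (x , x< , refl)))
      λ m → (λ _ → 0) , λ x x< → s≤s z≤n , λ { _ (_ , ()) }
    below none (suc n) n≤ = Covers-union
      (λ x (z , h<) → [ (λ h<n → inj₁ (z , h<n)) , (λ eq → inj₂ (InL-cons eq z)) ]′ (m≤n⇒m<n∨m≡n (≤-pred h<)))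
      (proj₂ (below none n (<⇒≤ n≤)))
      (proj₂ (byContra {∃ (Covers (InL (cons ⟨ γ , n ⟩ Λ)))} λ ¬cov → none (n , ≤-pred n≤ , λ v cov → ¬cov (v , cov))))

  -- The cell lies in one class of `colour w`, and that class misses a family of the rejection. An
  -- alive cell meets all families accepted before, so the missed one comes from the rejected
  -- triple. Its components are bounded by `w`.
  Rejected-misses : ∀ {e F Λ w n c} → let κ = ⟨ e , ⟨ F , Λ ⟩ ⟩; Λ' = cons ⟨ ⟨ n , w ⟩ , c ⟩ Λ in
    RejBy (cons κ (greedy κ)) w → Alive Λ' →
    ∃ λ τ → ∃ λ u → τ ≤ w × u ≤ w × Ext F τ (InL Λ) × (∀ m → ¬ MeetsBy (InL Λ') ⟨ e , ⟨ τ , u ⟩ ⟩ m)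
  Rejected-misses {e} {F} {Λ} {w} {n} {c} (inc , small) alive =
    let x , b≤ , inx = Alive-infinite alive (π₂ (π₂ w))
        j , j< , miss = missed x b≤
        i = nth j (π₂ (π₁ w))
        missL = λ m mt → miss m (MeetsBy-mono ≤-refl (λ y _ iny → tt , same inx iny) mt)
        i≤ : i ≤ w
        i≤ = ≤-trans (Mem-≤ (j , j< , refl)) (π₁-≤ w)
        τ≤ = ≤-trans (π₁-≤ _) (≤-trans (π₂-≤ _) i≤)
        u≤ = ≤-trans (π₂-≤ _) (≤-trans (π₂-≤ _) i≤)
        e≡ , ext = family i (inc j j<) missL
    in π₁ (π₂ i) , π₂ (π₂ i) , τ≤ , u≤ , ext , λ m → subst (λ i → ¬ MeetsBy (InL Λ') i m) (name i e≡) (missL m)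
    where
    κ = ⟨ e , ⟨ F , Λ ⟩ ⟩
    Λ' = cons ⟨ ⟨ n , w ⟩ , c ⟩ Λ
    name : ∀ i → π₁ i ≡ e → i ≡ ⟨ e , ⟨ π₁ (π₂ i) , π₂ (π₂ i) ⟩ ⟩
    name i refl = trans (sym (⟨⟩-η i)) (cong (λ r → ⟨ π₁ i , r ⟩) (sym (⟨⟩-η (π₂ i))))
    same : ∀ {x y} → InL Λ' x → InL Λ' y → colour w y ≡ colour w x
    same {x} {y} inx iny = trans (sym (eq y)) (trans (cong π₂ (trans (InL-head iny) (sym (InL-head inx)))) (eq x))
      where
      eq : ∀ z → π₂ (hue ⟨ n , w ⟩ z) ≡ colour w z
      eq z = trans (hue-colour ⟨ n , w ⟩ z) (cong (λ w → colour w z) (π₂-⟨⟩ n w))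
    missed : ∀ x → π₂ (π₂ w) ≤ x → ∃ λ j → j < π₁ (π₁ w) ×
             (∀ m → ¬ MeetsBy (Class Everything (colour w) x) (nth j (π₂ (π₁ w))) m)
    missed x b≤ = byContra λ none →
      -- One family must be missed at all levels: otherwise all are met by a common level M, against
      -- `colour-good` beyond M.
      let M , all = collect-bound {P = λ j m → MeetsBy (Class Everything (colour w) x) (nth j (π₂ (π₁ w))) m}
            (λ l → MeetsBy-mono l (λ _ _ → id)) (π₁ (π₁ w))
            (λ j j< → byContra λ ¬m → none (j , j< , λ m mt → ¬m (m , mt)))
          j , j< , miss = proj₂ (proj₂ (colour-good small (M + suc x) x (m≤n+m (suc x) M))) b≤ tt
      in miss (MeetsBy-mono (m≤m+n M (suc x)) (λ _ _ → id) (all j j<))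
    family : ∀ i → InC (cons κ (greedy κ)) i → (∀ m → ¬ MeetsBy (InL Λ') i m) → π₁ i ≡ e × Ext F (π₁ (π₂ i)) (InL Λ)
    family i inc miss with InC-cons⁻ inc
    ... | inj₁ (e≡ , ext) = trans e≡ (π₁-⟨⟩ _ _) ,
      subst₂ (λ F Λ → Ext F (π₁ (π₂ i)) (InL Λ)) (trans (cong π₁ (π₂-⟨⟩ e _)) (π₁-⟨⟩ F Λ))
                                               (trans (cong π₂ (π₂-⟨⟩ e _)) (π₂-⟨⟩ F Λ)) ext
    ... | inj₂ inc' = let τ , ext , r = Alive-meets alive inc' in ⊥-elim (miss τ (τ , ≤-refl , ext , r))

  -- Acceptance puts the family of τ and `u` into the collection, and alive reservoirs meet every
  -- family there.
  Accepted-meets : ∀ {e F Λ τ Λ' u} → let κ = ⟨ e , ⟨ F , Λ ⟩ ⟩ in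
    ¬ Rej (cons κ (greedy κ)) → Ext F τ (InL Λ) → Alive Λ' → ∃ λ σ → Ext τ σ (InL Λ') × ¬ NR e u σ
  Accepted-meets {e} {F} {Λ} {τ} {Λ'} {u} acc ext alive =
    let σ , ext' , r = Alive-meets {s = suc κ} alive inc in
    σ , subst (λ τ → Ext τ σ (InL Λ')) (trans (cong π₁ (π₂-⟨⟩ e _)) (π₁-⟨⟩ τ u)) ext' ,
    λ nr → r (subst₂ (λ e u → NR e u σ) (sym (π₁-⟨⟩ e _)) (sym (trans (cong π₂ (π₂-⟨⟩ e _)) (π₂-⟨⟩ τ u))) nr)
    where
    κ = ⟨ e , ⟨ F , Λ ⟩ ⟩
    i = ⟨ e , ⟨ τ , u ⟩ ⟩
    inc : InC (greedy (suc κ)) i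
    inc = Mem-InC (subst (Mem κ) (sym (greedy-acc acc)) Mem-here)
      (trans (π₁-⟨⟩ e _) (sym (π₁-⟨⟩ e _)) ,
       subst₂ (λ F Λ → Ext F (π₁ (π₂ i)) (InL Λ)) (sym (trans (cong π₁ (π₂-⟨⟩ e _)) (π₁-⟨⟩ F Λ)))
                                               (sym (trans (cong π₂ (π₂-⟨⟩ e _)) (π₂-⟨⟩ F Λ)))
         (subst (λ τ → Ext F τ (InL Λ)) (sym (trans (cong π₁ (π₂-⟨⟩ e _)) (π₁-⟨⟩ τ u))) ext))

-- The stages of the construction.

module Construction (em : ExcludedMiddle 0ℓ) (R : ℕ → Pred) (hR : seqSet R ≤T (∅ ′)) where

  open Computability em
  open Certificates em
  open Largeness em
  open Greedy em R hR

  private variable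
    A : Pred
    f g h : ℕ → ℕ

  r-∘₃ : ∀ {k : ℕ → ℕ → ℕ → ℕ} → Rec A (λ z → k (π₁ z) (π₁ (π₂ z)) (π₂ (π₂ z))) →
         Rec A f → Rec A g → Rec A h → Rec A (λ x → k (f x) (g x) (h x))
  r-∘₃ {f = f} {g} {h} {k} d r t u = rec-ext eq (d ∘r r-⟨⟩ r (r-⟨⟩ t u))
    where
    eq : ∀ x → k (π₁ ⟨ f x , ⟨ g x , h x ⟩ ⟩) (π₁ (π₂ ⟨ f x , ⟨ g x , h x ⟩ ⟩)) (π₂ (π₂ ⟨ f x , ⟨ g x , h x ⟩ ⟩))
             ≡ k (f x) (g x) (h x)
    eq x rewrite π₁-⟨⟩ (f x) ⟨ g x , h x ⟩ | π₂-⟨⟩ (f x) ⟨ g x , h x ⟩ | π₁-⟨⟩ (g x) (h x) | π₂-⟨⟩ (g x) (h x) = refl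

  -- A state `S` is a pair of a string and a reservoir, so `⟨ s , S ⟩` is literally the triple for
  -- program `s`.
  candidates : ℕ → ℕ → ℕ
  candidates s S = cons ⟨ s , S ⟩ (greedy ⟨ s , S ⟩)

  r-candidates : Rec ((∅ ′) ′) f → Rec ((∅ ′) ′) g → Rec ((∅ ′) ′) (λ x → candidates (f x) (g x))
  r-candidates s S = r-cons (r-⟨⟩ s S) (r-greedy (r-⟨⟩ s S))

  opaque
    -- For an accepted triple this is 0; the stage then still splits by a hue, and so by `R s`.
    rejection : ℕ → ℕ → ℕ
    rejection s S = leastOr 0 (RejBy (candidates s S))

    r-rejection : Rec ((∅ ′) ′) f → Rec ((∅ ′) ′) g → Rec ((∅ ′) ′) (λ x → rejection (f x) (g x))
    r-rejection {f} {g} s S = r-leastOr {q = λ x → RejBy (candidates (f x) (g x))} (r-const 0)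
      (d-∘₂ {q = RejBy} (d-via d-jump (d-RejBy (r-π₁ r-id) v0)) (r-candidates s S ↑) v0)
      (d-Rej (r-candidates s S))

    rejection-rejects : ∀ {s S} → Rej (candidates s S) → RejBy (candidates s S) (rejection s S)
    rejection-rejects = leastOr-∈ 0 _

  -- τ is taken inside the old reservoir, but the family must be missed by the new one. The bounds
  -- on τ and `u` come from `Rejected-misses`.
  Shrinks : ℕ → ℕ → ℕ → ℕ → Set
  Shrinks s S Λ τ = τ < suc (rejection s S) × Ext (π₁ S) τ (InL (π₂ S)) ×
    ∃ λ u → u < suc (rejection s S) × (∀ m → ¬ MeetsBy (InL Λ) ⟨ s , ⟨ τ , u ⟩ ⟩ m)

  Forces : ℕ → ℕ → ℕ → ℕ → Set
  Forces s F Λ τ = Ext F τ (InL Λ) × ¬ NR (π₁ s) (π₂ s) τ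

  Grows : ℕ → ℕ → ℕ → Set
  Grows F Λ τ = Ext F τ (InL Λ) × ∃ λ x → x < π₁ τ × (π₁ F ≤ x × τ ∋ x)

  d-InL₂ : Rec ((∅ ′) ′) f → Rec ((∅ ′) ′) g → Dcd ((∅ ′) ′) (λ x → InL (f x) (g x))
  d-InL₂ = d-∘₂ {q = InL} (d-via d-jump d-InL)

  d-InL₁ : Rec (∅ ′) f → Rec (∅ ′) g → Dcd (∅ ′) (λ x → InL (f x) (g x))
  d-InL₁ = d-∘₂ {q = InL} d-InL

  -- The three extensions of the string at stage s: decide membership of s in the double jump,
  -- meet requirement number s, add an element.
  opaque
    decided : ℕ → ℕ → ℕ → ℕ
    decided s S Λ = leastOr (π₁ S) (Shrinks s S Λ)

    decided-spec : ∀ s S Λ → Shrinks s S Λ (decided s S Λ) ⊎ (¬ ∃ (Shrinks s S Λ) × decided s S Λ ≡ π₁ S)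
    decided-spec s S Λ = leastOr-spec (π₁ S) (Shrinks s S Λ)

    r-decided : Rec ((∅ ′) ′) f → Rec ((∅ ′) ′) g → Rec ((∅ ′) ′) h → Rec ((∅ ′) ′) (λ x → decided (f x) (g x) (h x))
    r-decided {f} {g} {h} s S Λ = r-leastOr {q = λ x → Shrinks (f x) (g x) (h x)} (r-π₁ S)
      -- The clause over all m is Π₁(∅′), so ∅″ can test for existence only because τ and u are
      -- bounded.
      (d-× (d-< v0 (r-suc (r-rejection (s ↑) (S ↑)))) body) (d-b∃ (r-suc (r-rejection s S)) body)
      where
      body : Dcd ((∅ ′) ′) (λ z → Ext (π₁ (g (π₁ z))) (π₂ z) (InL (π₂ (g (π₁ z)))) ×
               ∃ λ u → u < suc (rejection (f (π₁ z)) (g (π₁ z))) ×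
                       (∀ m → ¬ MeetsBy (InL (h (π₁ z))) ⟨ f (π₁ z) , ⟨ π₂ z , u ⟩ ⟩ m))
      body = d-×
        (d-Ext {Z = λ z → InL (π₂ (g (π₁ z)))} (d-InL₂ (r-π₂ S ↑ ↑) v0) (r-π₁ S ↑) v0)
        (d-b∃ (r-suc (r-rejection (s ↑) (S ↑)))
          (d-∘₂ {q = λ Λ i → ∀ m → ¬ MeetsBy (InL Λ) i m}
            (d-∀ {q = λ z m → ¬ MeetsBy (InL (π₁ z)) (π₂ z) m}
              (d-¬ (d-MeetsBy {Y = λ z → InL (π₁ (π₁ z))} (d-InL₁ (r-π₁ (r-π₁ (r-π₁ r-id))) v0) v1 v0)))
            (Λ ↑ ↑) (r-⟨⟩ (s ↑ ↑) (r-⟨⟩ v1 v0))))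

    met : ℕ → ℕ → ℕ → ℕ
    met s F Λ = leastOr F (Forces s F Λ)

    met-spec : ∀ s F Λ → Forces s F Λ (met s F Λ) ⊎ (¬ ∃ (Forces s F Λ) × met s F Λ ≡ F)
    met-spec s F Λ = leastOr-spec F (Forces s F Λ)

    r-met : Rec ((∅ ′) ′) f → Rec ((∅ ′) ′) g → Rec ((∅ ′) ′) h → Rec ((∅ ′) ′) (λ x → met (f x) (g x) (h x))
    r-met = r-∘₃ {k = met} (r-leastOr {q = q} (r-π₁ v0) (d-via d-jump d) (d-∃ {q = q} d))
      where
      q : ℕ → ℕ → Set
      q z = Forces (π₁ z) (π₁ (π₂ z)) (π₂ (π₂ z))
      d : Dcd (∅ ′) (λ z → q (π₁ z) (π₂ z))
      d = d-× (d-Ext {Z = λ z → InL (π₂ (π₂ (π₁ z)))} (d-InL₁ (r-π₂ (r-π₂ (r-π₁ (r-π₁ r-id)))) v0) (r-π₁ v1) v0)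
              (d-¬ (d-NR (r-π₁ (r-π₁ (r-π₁ r-id))) (r-π₂ (r-π₁ (r-π₁ r-id))) v0))

    grown : ℕ → ℕ → ℕ
    grown F Λ = leastOr F (Grows F Λ)

    grown-spec : ∀ F Λ → ∃ (Grows F Λ) → Grows F Λ (grown F Λ)
    grown-spec F Λ = leastOr-∈ F (Grows F Λ)

    r-grown : Rec ((∅ ′) ′) f → Rec ((∅ ′) ′) g → Rec ((∅ ′) ′) (λ x → grown (f x) (g x))
    r-grown = r-∘₂ {k = grown} (r-leastOr {q = q} (r-π₁ r-id) (d-via d-jump d) (d-∃ {q = q} d))
      where
      q : ℕ → ℕ → Set
      q z = Grows (π₁ z) (π₂ z)
      d : Dcd (∅ ′) (λ z → q (π₁ z) (π₂ z))
      d = d-× (d-Ext {Z = λ z → InL (π₂ (π₁ z))} (d-InL₁ (r-π₂ (r-π₁ (r-π₁ r-id))) v0) (r-π₁ (r-π₁ r-id)) v0)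
              (d-b∃ (r-π₁ v0) (d-× (d-≤ (r-π₁ (r-π₁ (r-π₁ (r-π₁ r-id)))) v0) (d-∋ v1 v0)))

  next : ℕ → ℕ → ℕ → ℕ
  next s S Λ = ⟨ grown (met s (decided s S Λ) Λ) Λ , Λ ⟩

  r-next : Rec ((∅ ′) ′) f → Rec ((∅ ′) ′) g → Rec ((∅ ′) ′) h → Rec ((∅ ′) ′) (λ x → next (f x) (g x) (h x))
  r-next s S Λ = r-⟨⟩ (r-grown (r-met s (r-decided s S Λ) Λ) Λ) Λ

  -- Cell `c` of the reservoir under the hue that combines `R s` with the colouring from the
  -- rejection.
  option : ℕ → ℕ → ℕ → ℕ
  option s S c = cons ⟨ ⟨ s , rejection s S ⟩ , c ⟩ (π₂ S)

  r-option : Rec ((∅ ′) ′) f → Rec ((∅ ′) ′) g → Rec ((∅ ′) ′) h → Rec ((∅ ′) ′) (λ x → option (f x) (g x) (h x))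
  r-option s S c = r-cons (r-⟨⟩ (r-⟨⟩ s (r-rejection s S)) c) (r-π₂ S)

  Grows-total : ∀ {F Λ} → Alive Λ → ∃ (Grows F Λ)
  Grows-total {F} {Λ} alive with Alive-infinite alive (π₁ F)
  ... | x , F≤x , inx = τ , ((≤-trans F≤x (≤-trans (n≤1+n x) (≤-reflexive (sym len))) , λ y y< →
          (λ p → trans (bit y (≤-trans y< (m≤n⇒m≤1+n F≤x))) (trans (old y y<) p)) ,
          (λ p → trans (sym (old y y<)) (trans (sym (bit y (≤-trans y< (m≤n⇒m≤1+n F≤x)))) p))) ,
        λ y y< F≤y p → new y (subst (y <_) len y<) F≤y (trans (sym (bit y (subst (y <_) len y<))) p)) ,
      x , subst (x <_) (sym len) ≤-refl , F≤x , trans (bit x ≤-refl) (last x F≤x refl)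
    where
    -- The bits of F, then zeros, then a single one at x.
    b : ℕ → ℕ
    b y = if0 (χ (y < π₁ F)) (χ (y ≡ x)) (nth y (π₂ F))
    τ = list (suc x) b
    len : π₁ τ ≡ suc x
    len = π₁-⟨⟩ _ _
    bit : ∀ y → y < suc x → nth y (π₂ τ) ≡ b y
    bit y y< = trans (cong (nth y) (π₂-⟨⟩ _ _)) (nth-tab b (suc x) y y<)
    old : ∀ y → y < π₁ F → b y ≡ nth y (π₂ F)
    old y y< = cong (λ n → if0 n (χ (y ≡ x)) (nth y (π₂ F))) (χ-yes y<)
    fresh : ∀ y → π₁ F ≤ y → b y ≡ χ (y ≡ x)
    fresh y F≤y = cong (λ n → if0 n (χ (y ≡ x)) (nth y (π₂ F))) (χ-no (≤⇒≯ F≤y))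
    last : ∀ y → π₁ F ≤ y → y ≡ x → b y ≡ 1
    last y F≤y eq = trans (fresh y F≤y) (χ-yes eq)
    new : ∀ y → y < suc x → π₁ F ≤ y → b y ≡ 1 → InL Λ y
    new y _ F≤y p = subst (InL Λ) (sym (χ-inv (trans (sym (fresh y F≤y)) p))) inx

  opaque
    -- The choice of cells is a parameter because the same recursion is run twice: with the choices
    -- made by `P`, and with choices recovered from the finished set.
    states : (ℕ → ℕ → ℕ) → ℕ → ℕ
    states choose = natrec 0 (λ s S → next s S (choose s S))

    states-zero : ∀ choose → states choose 0 ≡ 0
    states-zero choose = refl

    states-suc : ∀ choose s → states choose (suc s) ≡ next s (states choose s) (choose s (states choose s))
    states-suc choose s = refl

    r-states : ∀ {choose} → Dcd A ((∅ ′) ′) → Rec A (λ z → choose (π₁ (π₂ z)) (π₂ (π₂ z))) →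
               Rec A f → Rec A (λ x → states choose (f x))
    r-states {choose = choose} d r = r-natrec {s = λ _ s S → next s S (choose s S)} (r-const 0)
      (r-∘₃ {k = next} (r-via d (r-next (r-π₁ r-id) (r-π₁ v0) (r-π₂ v0))) (r-π₁ v0) (r-π₂ v0) r)

  -- The constructed set, for any choice of cells that preserves aliveness.

  module Generic (choose : ℕ → ℕ → ℕ)
                 (choose-option : ∀ s S → ∃ λ c → choose s S ≡ option s S c)
                 (choose-alive : ∀ s S → Alive (π₂ S) → Alive (choose s S)) where

    st : ℕ → ℕ
    st = states choose

    F Λ D : ℕ → ℕ
    F s = π₁ (st s)
    Λ s = π₂ (st s)
    D s = decided s (st s) (Λ (suc s))

    Λ-suc : ∀ s → Λ (suc s) ≡ choose s (st s)
    Λ-suc s = trans (cong π₂ (states-suc choose s)) (π₂-⟨⟩ _ _)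

    F-suc : ∀ s → F (suc s) ≡ grown (met s (D s) (Λ (suc s))) (Λ (suc s))
    F-suc s = trans (trans (cong π₁ (states-suc choose s)) (π₁-⟨⟩ _ _))
      (cong (λ Λ → grown (met s (decided s (st s) Λ) Λ) Λ) (sym (Λ-suc s)))

    alive : ∀ s → Alive (Λ s)
    alive zero = subst Alive (sym (trans (cong π₂ (states-zero choose)) (proj₂ π-zero))) Alive-nil
    alive (suc s) = subst Alive (sym (Λ-suc s)) (choose-alive s (st s) (alive s))

    shrink : ∀ s {x} → InL (Λ (suc s)) x → InL (Λ s) x
    shrink s {x} i with choose-option s (st s)
    ... | c , eq = InL-tail (subst (λ Λ → InL Λ x) (trans (Λ-suc s) eq) i)

    ext-decided : ∀ s → Ext (F s) (D s) (InL (Λ s))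
    ext-decided s with decided-spec s (st s) (Λ (suc s))
    ... | inj₁ (_ , e , _) = e
    ... | inj₂ (_ , eq) = subst (λ τ → Ext (F s) τ (InL (Λ s))) (sym eq) Ext-refl

    ext-met : ∀ s → Ext (D s) (met s (D s) (Λ (suc s))) (InL (Λ (suc s)))
    ext-met s with met-spec s (D s) (Λ (suc s))
    ... | inj₁ (e , _) = e
    ... | inj₂ (_ , eq) = subst (λ τ → Ext (D s) τ (InL (Λ (suc s)))) (sym eq) Ext-refl

    grows : ∀ s → Grows (met s (D s) (Λ (suc s))) (Λ (suc s)) (F (suc s))
    grows s = subst (Grows (met s (D s) (Λ (suc s))) (Λ (suc s))) (sym (F-suc s))
                    (grown-spec _ _ (Grows-total (alive (suc s))))

    ext-after : ∀ s → Ext (D s) (F (suc s)) (InL (Λ (suc s)))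
    ext-after s = Ext-trans (ext-met s) (proj₁ (grows s))

    ext-suc : ∀ s → Ext (F s) (F (suc s)) (InL (Λ s))
    ext-suc s = Ext-trans (ext-decided s) (Ext-mono (λ x _ → shrink s) (ext-after s))

    shrink* : ∀ {s} d {x} → InL (Λ (d + s)) x → InL (Λ s) x
    shrink* zero i = i
    shrink* (suc d) i = shrink* d (shrink (d + _) i)

    ext* : ∀ {s} d → Ext (F s) (F (d + s)) (InL (Λ s))
    ext* zero = Ext-refl
    ext* {s} (suc d) = Ext-trans (ext* d) (Ext-mono (λ x _ → shrink* d) (ext-suc (d + s)))

    ext-≤ : ∀ {s t} → s ≤ t → Ext (F s) (F t) (InL (Λ s))
    ext-≤ {s} {t} s≤t = subst (λ t → Ext (F s) (F t) (InL (Λ s))) (m∸n+n≡m s≤t) (ext* (t ∸ s))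

    ext-after-≤ : ∀ {s t} → s < t → Ext (D s) (F t) (InL (Λ (suc s)))
    ext-after-≤ {s} s<t = Ext-trans (ext-after s) (ext-≤ s<t)

    new-element : ∀ s → ∃ λ x → x < π₁ (F (suc s)) × (π₁ (F s) ≤ x × F (suc s) ∋ x)
    new-element s =
      let x , x< , ≤x , b = proj₂ (grows s) in
      x , x< , ≤-trans (proj₁ (proj₁ (ext-decided s))) (≤-trans (proj₁ (proj₁ (ext-met s))) ≤x) , b

    len-F : ∀ s → s ≤ π₁ (F s)
    len-F zero = z≤n
    len-F (suc s) = let x , x< , ≤x , _ = new-element s in ≤-trans (s≤s (≤-trans (len-F s) ≤x)) x<

    X : Pred
    X x = F (suc x) ∋ x

    F-≺-X : ∀ s → F s ≺ X
    F-≺-X s x x< with ≤-total s (suc x)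
    ... | inj₁ s≤ = proj₂ (proj₁ (ext-≤ s≤)) x x<
    ... | inj₂ ≤s = let p , q = proj₂ (proj₁ (ext-≤ ≤s)) x (len-F (suc x)) in q , p

    X-in : ∀ s {x} → X x → π₁ (D s) ≤ x → InL (Λ (suc s)) x
    -- The stage s + x + 1 comes after s and its string is longer than x.
    X-in s {x} xx ≤x = proj₂ (ext-after-≤ {s} {suc (s + x)} (s≤s (m≤m+n s x))) x x< ≤x
        (proj₂ (F-≺-X (suc (s + x)) x x<) xx)
      where x< = ≤-trans (s≤s (m≤n+m x s)) (len-F (suc (s + x)))

    X-hue : ∀ s {x c} → choose s (st s) ≡ option s (st s) c → X x → π₁ (D s) ≤ x →
            hue ⟨ s , rejection s (st s) ⟩ x ≡ c
    X-hue s {x} eq xx ≤x = InL-head (subst (λ Λ → InL Λ x) (trans (Λ-suc s) eq) (X-in s xx ≤x))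

    X-side : ∀ n {x c} → choose n (st n) ≡ option n (st n) c → X x → π₁ (D n) ≤ x → χ (R n x) ≡ π₁ c
    X-side n {x} eq xx ≤x = trans (cong (λ n → χ (R n x)) (sym (π₁-⟨⟩ n _)))
                                  (trans (sym (hue-χ _ x)) (cong π₁ (X-hue n eq xx ≤x)))

    infinite : Infinite X
    infinite m = let x , x< , ≤x , b = new-element m in
      x , ≤-trans (len-F m) ≤x , proj₁ (F-≺-X (suc m) x x<) b

    cohesive : Cohesive R X
    cohesive = infinite , side
      where
      bounded : ∀ b (Y : Pred) → (∀ x → X x → b ≤ x → ¬ Y x) → Finite (λ x → X x × Y x)
      bounded b Y h = b , λ x (xx , y) → ≰⇒> λ b≤x → h x xx b≤x y
      side : ∀ n → Finite (λ x → X x × ¬ R n x) ⊎ Finite (λ x → X x × R n x)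
      side n with choose-option n (st n)
      ... | c , eq with em {π₁ c ≡ 1}
      ...   | yes c≡1 = inj₁ (bounded (π₁ (D n)) (λ x → ¬ R n x) λ x xx b≤x ¬r → ¬r (χ-inv (trans (X-side n eq xx b≤x) c≡1)))
      ...   | no c≢1 = inj₂ (bounded (π₁ (D n)) (R n) λ x xx b≤x r → c≢1 (trans (sym (X-side n eq xx b≤x)) (χ-yes r)))

    Rejected : ℕ → Set
    Rejected e = Rej (candidates e (st e))

    -- By `Rejected-misses` the first extension succeeds. No later string can then refute its `u`,
    -- so `u` is a true witness.
    rejected⇒double-jump : ∀ e → Rejected e → ((X ′) ′) e
    rejected⇒double-jump e rej with decided-spec e (st e) (Λ (suc e))
    ... | inj₂ (none , _) with choose-option e (st e)
    ...   | c , eq = let τ , u , τ≤ , u≤ , ext , miss = Rejected-misses rej' alive' in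
      ⊥-elim (none (τ , s≤s τ≤ , ext , u , s≤s u≤ ,
        subst (λ Λ → ∀ m → ¬ MeetsBy (InL Λ) ⟨ e , ⟨ τ , u ⟩ ⟩ m) (sym eq') miss))
      where
      eq' : Λ (suc e) ≡ option e (st e) c
      eq' = trans (Λ-suc e) eq
      alive' : Alive (option e (st e) c)
      alive' = subst Alive eq' (alive (suc e))
      rej' : RejBy (cons ⟨ e , ⟨ F e , Λ e ⟩ ⟩ (greedy ⟨ e , ⟨ F e , Λ e ⟩ ⟩)) (rejection e (st e))
      rej' = subst (λ S → RejBy (candidates e S) (rejection e (st e))) (sym (⟨⟩-η (st e))) (rejection-rejects rej)
    rejected⇒double-jump e rej | inj₁ (_ , _ , u , _ , miss) = normal-double-jump X {u = u} λ σ σ≺X →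
      -- A stage after e whose string is at least as long as σ.
      let t = suc (e + π₁ σ)
          σ≤ = ≤-trans (m≤n+m (π₁ σ) (suc e)) (len-F t)
      in byContra λ refuted → miss' t (s≤s (m≤m+n e (π₁ σ)))
           (λ nr → refuted (NR-antitone (σ≤ , λ x x<σ →
              let p , q = F-≺-X t x (≤-trans x<σ σ≤)
                  p' , q' = σ≺X x x<σ in (q ∘ p') , (q' ∘ p)) nr))
      where
      miss' : ∀ t → e < t → ¬ ¬ NR e u (F t)
      miss' t e<t ¬nr = miss (F t) (F t , ≤-refl ,
        subst (λ τ → Ext τ (F t) (InL (Λ (suc e)))) (sym (trans (cong π₁ (π₂-⟨⟩ e _)) (π₁-⟨⟩ (D e) u))) (ext-after-≤ e<t) ,
        λ nr → ¬nr (subst₂ (λ e u → NR e u (F t)) (π₁-⟨⟩ e _) (trans (cong π₂ (π₂-⟨⟩ e _)) (π₂-⟨⟩ (D e) u)) nr))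

    -- Were the triple accepted, stage `⟨ e , u ⟩` would refute the true witness `u`.
    double-jump⇒rejected : ∀ e → ((X ′) ′) e → Rejected e
    double-jump⇒rejected e j = byContra λ acc →
      let u , nr = double-jump-normal X j in refuted acc u (nr _ (F-≺-X (suc ⟨ e , u ⟩)))
      where
      refuted : ¬ Rejected e → ∀ u → ¬ NR e u (F (suc ⟨ e , u ⟩))
      refuted acc u nr = r (NR-antitone (proj₁ (proj₁ (grows s))) nr)
        where
        s = ⟨ e , u ⟩
        -- The pair is no smaller than e, so at stage s the string already extends `F e` inside
        -- `Λ e`, as acceptance requires.
        e≤s : e ≤ s
        e≤s = subst (_≤ s) (π₁-⟨⟩ e u) (π₁-≤ s)
        acc' : ¬ Rej (cons ⟨ e , ⟨ F e , Λ e ⟩ ⟩ (greedy ⟨ e , ⟨ F e , Λ e ⟩ ⟩))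
        acc' = subst (λ S → ¬ Rej (candidates e S)) (sym (⟨⟩-η (st e))) acc
        from-e : Ext (F e) (D s) (InL (Λ e))
        from-e = Ext-trans (ext-≤ e≤s) (Ext-mono (λ x _ i → later e≤s i) (ext-decided s))
          where
          later : ∀ {t t' x} → t ≤ t' → InL (Λ t') x → InL (Λ t) x
          later {t} {t'} {x} l i = shrink* (t' ∸ t) (subst (λ t → InL (Λ t) x) (sym (m∸n+n≡m l)) i)
        r : ¬ NR e u (met s (D s) (Λ (suc s)))
        r with met-spec s (D s) (Λ (suc s))
        ... | inj₁ (_ , r) = subst₂ (λ e u → ¬ NR e u (met s (D s) (Λ (suc s)))) (π₁-⟨⟩ e u) (π₂-⟨⟩ e u) r
        ... | inj₂ (none , _) = let σ , ext , r = Accepted-meets {u = u} acc' from-e (alive (suc s)) in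
          ⊥-elim (none (σ , ext , subst₂ (λ e u → ¬ NR e u σ) (sym (π₁-⟨⟩ e u)) (sym (π₂-⟨⟩ e u)) r))

-- Joins, and detecting dead reservoirs.

module Choice (em : ExcludedMiddle 0ℓ) (R : ℕ → Pred) (hR : seqSet R ≤T (∅ ′)) where

  open Computability em
  open Certificates em
  open Largeness em
  open Greedy em R hR
  open Construction em R hR

  double : ∀ n → 2 * n ≡ n + n
  double n = cong (n +_) (+-identityʳ n)

  double-injective : ∀ m n → m + m ≡ n + n → m ≡ n
  double-injective m n p = *-cancelˡ-≡ m n 2 (trans (double m) (trans p (sym (double n))))

  double≢suc-double : ∀ m n → m + m ≡ suc (n + n) → ⊥
  double≢suc-double m n p = even≢odd m n (trans (double m) (trans p (cong suc (sym (double n)))))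

  private variable
    A B C : Pred
    f g h : ℕ → ℕ

  d-⊕ˡ : Dcd (A ⊕ B) A
  d-⊕ˡ {A} {B} = d-resp from (λ x a → x , inj₁ (refl , a)) (d-∘ d-oracle (r-+ r-id r-id))
    where
    from : ∀ x → (A ⊕ B) (x + x) → A x
    from x (k , inj₁ (p , a)) = subst A (sym (double-injective x k p)) a
    from x (k , inj₂ (p , _)) = ⊥-elim (double≢suc-double x k p)

  d-⊕ʳ : Dcd (A ⊕ B) B
  d-⊕ʳ {A} {B} = d-resp from (λ x b → x , inj₂ (refl , b)) (d-∘ d-oracle (r-suc (r-+ r-id r-id)))
    where
    from : ∀ x → (A ⊕ B) (suc (x + x)) → B x
    from x (k , inj₁ (p , _)) = ⊥-elim (double≢suc-double k x (sym p))
    from x (k , inj₂ (p , b)) = subst B (sym (double-injective x k (suc-injective p))) b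

  d-⊕ : Dcd C A → Dcd C B → Dcd C (A ⊕ B)
  d-⊕ {C} {A} {B} a b = d-∃≤ {q = λ x k → (x ≡ k + k × A k) ⊎ (x ≡ suc (k + k) × B k)} r-id bound
    (d-⊎ (d-× (d-≡ (r-π₁ r-id) (r-+ v0 v0)) (d-∘ a v0)) (d-× (d-≡ (r-π₁ r-id) (r-suc (r-+ v0 v0))) (d-∘ b v0)))
    where
    bound : ∀ x k → (x ≡ k + k × A k) ⊎ (x ≡ suc (k + k) × B k) → k ≤ x
    bound x k (inj₁ (refl , _)) = m≤m+n k k
    bound x k (inj₂ (refl , _)) = ≤-trans (m≤m+n k k) (n≤1+n _)

  -- The program that diverges on ⟨ Λ , Λ' ⟩ when both reservoirs are alive, and otherwise outputs the index
  -- of one that is not: a function avoiding it points at a reservoir that is alive if one of them is.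
  Dies : ℕ → ℕ → Set
  Dies x w = Covers (InL (π₁ x)) w ⊎ Covers (InL (π₂ x)) w

  d-Dies : Dcd ((∅ ′) ′) (λ z → Dies (π₁ z) (π₂ z))
  d-Dies = d-⊎ (d-Covers (r-π₁ (r-π₁ r-id)) v0) (d-Covers (r-π₂ (r-π₁ r-id)) v0)

  dies₁ : ∀ {Λ Λ' v} → Covers (InL Λ) v → Dies ⟨ Λ , Λ' ⟩ v
  dies₁ {Λ} {Λ'} {v} c = inj₁ (subst (λ a → Covers (InL a) v) (sym (π₁-⟨⟩ Λ Λ')) c)

  dies₂ : ∀ {Λ Λ' v} → Covers (InL Λ') v → Dies ⟨ Λ , Λ' ⟩ v
  dies₂ {Λ} {Λ'} {v} c = inj₂ (subst (λ a → Covers (InL a) v) (sym (π₂-⟨⟩ Λ Λ')) c)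

  victim : ℕ → ℕ → ℕ
  victim x w = if0 (χ (Covers (InL (π₁ x)) w)) 1 0

  r-victim : Rec ((∅ ′) ′) (λ z → victim (π₁ z) (π₂ z))
  r-victim = r-if0 (r-χ (d-Covers (r-π₁ (r-π₁ r-id)) v0)) (r-const 1) (r-const 0)

  opaque
    victimCode : Code
    victimCode = Cc (Rec.prog r-victim) (Pc Ic (search {q = Dies} d-Dies))

    victim-eval : ∀ x → ∃ (Dies x) → Eval ((∅ ′) ′) victimCode x (victim x (min (Dies x)))
    victim-eval x p = ev-C (ev-P ev-I (search-run {q = Dies} d-Dies x p))
      (subst₂ (λ y w → Eval ((∅ ′) ′) (Rec.prog r-victim) (pair x (min (Dies x))) (victim y w))
        (trans (cong π₁ (sym (⟨⟩-pair x _))) (π₁-⟨⟩ x _)) (trans (cong π₂ (sym (⟨⟩-pair x _))) (π₂-⟨⟩ x _))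
        (Rec.run r-victim (pair x (min (Dies x)))))

  -- Choosing alive cells with a PA function, and retracing the choices.

  module Diagonal {P : Pred} (p : ℕ → ℕ) (r-p : Rec P p) (pa : IsPA ((∅ ′) ′) p) where

    avoids : ∀ c x {y} → Eval ((∅ ′) ′) c x y → p (index c x) ≢ y
    avoids c x {y} e = proj₂ pa (index c x) y (index-eval c x e)

    bit : ∀ e → p e ≡ 0 ⊎ p e ≡ 1
    bit e with p e | proj₁ pa e
    ... | zero | _ = inj₁ refl
    ... | suc zero | _ = inj₂ refl
    ... | suc (suc _) | s≤s ()

    -- The two-valued `p` avoids the value of the oracle program at `x`, so it is the complement of
    -- ∅″ there.
    d₂ : Dcd P ((∅ ′) ′)
    d₂ = d-char (r-if0 (r-p ∘r r-index Oc r-id) (r-const 1) (r-const 0)) yes' no'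
      where
      yes' : ∀ x → ((∅ ′) ′) x → if0 (p (index Oc x)) 1 0 ≡ 1
      yes' x a with bit (index Oc x)
      ... | inj₁ eq = cong (λ n → if0 n 1 0) eq
      ... | inj₂ eq = ⊥-elim (avoids Oc x (ev-O1 a) eq)
      no' : ∀ x → ¬ ((∅ ′) ′) x → if0 (p (index Oc x)) 1 0 ≡ 0
      no' x ¬a with bit (index Oc x)
      ... | inj₁ eq = ⊥-elim (avoids Oc x (ev-O0 ¬a) eq)
      ... | inj₂ eq = cong (λ n → if0 n 1 0) eq

    pick : ℕ → ℕ → ℕ
    pick Λ Λ' = if0 (p (index victimCode ⟨ Λ , Λ' ⟩)) Λ Λ'

    r-pick : Rec P f → Rec P g → Rec P (λ x → pick (f x) (g x))
    r-pick a b = r-if0 (r-p ∘r r-index victimCode (r-⟨⟩ a b)) a b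

    pick-either : ∀ Λ Λ' → pick Λ Λ' ≡ Λ ⊎ pick Λ Λ' ≡ Λ'
    pick-either Λ Λ' with bit (index victimCode ⟨ Λ , Λ' ⟩)
    ... | inj₁ eq = inj₁ (cong (λ n → if0 n Λ Λ') eq)
    ... | inj₂ eq = inj₂ (cong (λ n → if0 n Λ Λ') eq)

    pick-alive : ∀ Λ Λ' → Alive Λ ⊎ Alive Λ' → Alive (pick Λ Λ')
    pick-alive Λ Λ' either = [ first , second ]′ (bit (index victimCode x))
      where
      x = ⟨ Λ , Λ' ⟩
      not-both : ∀ v v' → Covers (InL Λ) v → Covers (InL Λ') v' → ⊥
      not-both v v' c c' = [ (λ al → al v c) , (λ al → al v' c') ]′ either
      choice : ∀ {n} → p (index victimCode x) ≡ n → if0 n Λ Λ' ≡ pick Λ Λ'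
      choice eq = cong (λ n → if0 n Λ Λ') (sym eq)
      died : ∃ (Dies x) → Dies x (min (Dies x))
      died = min-∈ (Dies x)
      first : p (index victimCode x) ≡ 0 → Alive (pick Λ Λ')
      first eq = subst Alive (choice eq) λ v c → go v c (died (v , dies₁ c))
        where
        go : ∀ v → Covers (InL Λ) v → Dies x (min (Dies x)) → ⊥
        -- The search may stop on a cover of the second reservoir, but then both would be dead.
        go v c (inj₂ c') = not-both v _ c (subst (λ b → Covers (InL b) (min (Dies x))) (π₂-⟨⟩ Λ Λ') c')
        go v c (inj₁ c') = avoids victimCode x (victim-eval x (v , dies₁ c))
          (trans eq (sym (cong (λ n → if0 n 1 0) (χ-yes c'))))
      second : p (index victimCode x) ≡ 1 → Alive (pick Λ Λ')
      second eq = subst Alive (choice eq) λ v c → not-both _ v (go v c) c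
        where
        go : ∀ v → Covers (InL Λ') v → Covers (InL Λ) (min (Dies x))
        go v c = subst (λ b → Covers (InL b) (min (Dies x))) (π₁-⟨⟩ Λ Λ') (byContra λ ¬c →
          avoids victimCode x (victim-eval x (v , dies₂ c)) (trans eq (sym (cong (λ n → if0 n 1 0) (χ-no ¬c)))))

    tournament : ℕ → ℕ → ℕ → ℕ
    tournament s S = natrec (option s S 0) (λ c Λ → pick Λ (option s S (suc c)))

    tournament-option : ∀ s S n → ∃ λ c → tournament s S n ≡ option s S c
    tournament-option s S zero = 0 , refl
    tournament-option s S (suc n) with pick-either (tournament s S n) (option s S (suc n))
    ... | inj₁ eq = let c , eq' = tournament-option s S n in c , trans eq eq'
    ... | inj₂ eq = suc n , eq

    -- From the round in which an alive option enters, the current winner is alive.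
    tournament-alive : ∀ s S n {c} → c ≤ n → Alive (option s S c) → Alive (tournament s S n)
    tournament-alive s S zero z≤n al = al
    tournament-alive s S (suc n) c≤ al = pick-alive _ _
      ([ (λ c< → inj₁ (tournament-alive s S n (≤-pred c<) al)) , (λ { refl → inj₂ al }) ]′ (m≤n⇒m<n∨m≡n c≤))

    options : ℕ → ℕ → ℕ
    options s S = ⟨ 1 , π₁ (π₂ (rejection s S)) ⟩

    choose : ℕ → ℕ → ℕ
    choose s S = tournament s S (options s S)

    choose-alive : ∀ s S → Alive (π₂ S) → Alive (choose s S)
    choose-alive s S al =
      let c , c≤ , al' = Alive-split al ⟨ s , rejection s S ⟩ in
      tournament-alive s S (options s S) (subst (λ w → c ≤ ⟨ 1 , π₁ (π₂ w) ⟩) (π₂-⟨⟩ s (rejection s S)) c≤) al'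

    r-choose : Rec P (λ z → choose (π₁ (π₂ z)) (π₂ (π₂ z)))
    r-choose = r-natrec {s = λ z c Λ → pick Λ (option (π₁ (π₂ z)) (π₂ (π₂ z)) (suc c))}
      (opt s S (r-const 0)) (r-pick (r-π₂ v0) (opt (s ↑) (S ↑) (r-suc (r-π₁ v0))))
      (r-⟨⟩ (r-const 1) (r-π₁ (r-π₂ (r-∘₂ {k = rejection} (r-via d₂ (r-rejection (r-π₁ r-id) v0)) s S))))
      where
      opt : Rec P f → Rec P g → Rec P h → Rec P (λ x → option (f x) (g x) (h x))
      opt = r-∘₃ {k = option} (r-via d₂ (r-option (r-π₁ r-id) (r-π₁ v0) (r-π₂ v0)))
      s : Rec P (λ z → π₁ (π₂ z))
      s = r-π₁ v0
      S : Rec P (λ z → π₂ (π₂ z))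
      S = r-π₂ v0

    open Generic choose (λ s S → tournament-option s S (options s S)) choose-alive

    d-X : Dcd P X
    d-X = d-∋ (r-π₁ (r-states d₂ r-choose (r-suc r-id))) r-id

    -- The string `D s` depends on the cell still to be recovered. The sum bounds its code, hence
    -- its length, without knowing that cell.
    Later : ℕ → ℕ → ℕ → Set
    Later s S x = S + rejection s S ≤ x × X x

    -- The choice at stage s is the hue of any later element of X.
    recover : ℕ → ℕ → ℕ
    recover s S = option s S (hue ⟨ s , rejection s S ⟩ (min (Later s S)))

    Later-total : ∀ s S → ∃ (Later s S)
    Later-total s S = infinite (S + rejection s S)

    recover-choose : ∀ s → recover s (st s) ≡ choose s (st s)
    recover-choose s =
      let c , eq = tournament-option s (st s) (options s (st s))
          ≤x , xx = min-∈ (Later s (st s)) (Later-total s (st s))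
      in trans (cong (option s (st s)) (X-hue s eq xx (≤-trans (≤-trans (π₁-≤ (D s)) D≤) ≤x))) (sym eq)
      where
      D≤ : D s ≤ st s + rejection s (st s)
      D≤ = [ (λ (τ≤ , _) → ≤-trans (≤-pred τ≤) (m≤n+m _ (st s)))
           , (λ (_ , eq) → ≤-trans (≤-reflexive eq) (≤-trans (π₁-≤ (st s)) (m≤m+n (st s) _))) ]′
           (decided-spec s (st s) (Λ (suc s)))

    recover-states : ∀ s → states recover s ≡ st s
    recover-states zero = trans (states-zero recover) (sym (states-zero choose))
    recover-states (suc s) = trans (states-suc recover s)
      (trans (cong (λ S → next s S (recover s S)) (recover-states s))
      (trans (cong (next s (st s)) (recover-choose s)) (sym (states-suc choose s))))

    r-recover : Rec (X ⊕ ((∅ ′) ′)) (λ z → recover (π₁ (π₂ z)) (π₂ (π₂ z)))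
    r-recover = r-∘₃ {k = option} (r-via d-⊕ʳ (r-option (r-π₁ r-id) (r-π₁ v0) (r-π₂ v0))) s S
      (r-∘₂ {k = hue} (r-via (d-via d-⊕ʳ d-jump) (r-hue (r-π₁ r-id) v0)) (r-⟨⟩ s w)
        (r-min {q = λ z → Later (π₁ (π₂ z)) (π₂ (π₂ z))}
          (d-× (d-≤ (r-+ (S ↑) (w ↑)) v0) (d-∘ d-⊕ˡ v0)) (λ z → Later-total _ _)))
      where
      s : Rec (X ⊕ ((∅ ′) ′)) (λ z → π₁ (π₂ z))
      s = r-π₁ v0
      S : Rec (X ⊕ ((∅ ′) ′)) (λ z → π₂ (π₂ z))
      S = r-π₂ v0
      w : Rec (X ⊕ ((∅ ′) ′)) (λ z → rejection (π₁ (π₂ z)) (π₂ (π₂ z)))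
      w = r-∘₂ {k = rejection} (r-via d-⊕ʳ (r-rejection (r-π₁ r-id) v0)) s S

    -- Membership of `e` in the double jump is the rejection of the triple at stage `e`, which ∅″
    -- decides once the state has been retraced.
    d-X″ : Dcd (X ⊕ ((∅ ′) ′)) ((X ′) ′)
    d-X″ = d-resp rejected⇒double-jump double-jump⇒rejected
      (d-∘₂ {q = λ s S → Rej (candidates s S)} (d-via d-⊕ʳ (d-Rej (r-candidates (r-π₁ r-id) v0))) r-id
        (rec-ext recover-states (r-states d-⊕ʳ r-recover r-id)))

    solution : Σ Pred λ X → Cohesive R X × (((X ′) ′) ≤T (X ⊕ ((∅ ′) ′))) × ((X ⊕ ((∅ ′) ′)) ≤T P)
    solution = X , cohesive , toT d-X″ , toT (d-⊕ d-X d₂)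

theorem3p4 : ExcludedMiddle 0ℓ → (P : Pred) → P ≫ ((∅ ′) ′) →
    (R : ℕ → Pred) → seqSet R ≤T (∅ ′) →
    Σ Pred λ X → Cohesive R X × (((X ′) ′) ≤T (X ⊕ ((∅ ′) ′))) × ((X ⊕ ((∅ ′) ′)) ≤T P)
theorem3p4 em P (p , (c , run) , pa) R hR =
  Choice.Diagonal.solution em R hR p (Computability.rec c run) pa
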